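{- (i) For every nonnegative integer $k$ and every graph $G$, if $G$ is reduced for $(2,k)$-LCP and has at least $8k$ edges, then $G\in(2,k)$-LCP. (ii) Consequently, the problem $(2,k)$-Load Coloring, parameterized by $k$ (with $k\ge 1$), admits a kernel with less than $8k$ edges.
   Context: Graphs are finite, simple and undirected; $N(v)$ is the set of neighbors of $v$; $[c]=\{1,\dots,c\}$. $(c,k)$-Load Coloring: given a graph $G=(V,E)$, a positive integer $c$ and a nonnegative integer $k$, decide whether there is a map $\varphi:V\to[c]$ such that for every $i\in[c]$ at least $k$ edges have both endvertices colored $i$. Write $G\in(c,k)$-LCP if such a $\varphi$ exists. Obstacle: for integers $i,k\ge 0$, a pair $(V_1,V_2)$ of disjoint vertex sets of $G$ with $V_1\cup V_2\neq\emptyset$ is an obstacle from $O_{i,k}$ if $|V_1|=i$, $N(v)\subseteq V_1$ for all $v\in V_2$, and for every $u\in V_1$ there is a set $V_u\subseteq N(u)\cap V_2$ with $|V_u|\ge k$ such that $V_u\cap V_v=\emptyset$ for all distinct $u,v\in V_1$. (For example, if $v$ is an isolated vertex, then $(\emptyset,\{v\})$ is an obstacle from $O_{0,k}$.) Reduction rule $R_{i,k}$: if an instance $G$ of $(c,k)$-LCP contains an obstacle $(V_1,V_2)$ from $O_{i,k}$, delete all vertices of $V_1\cup V_2$ and decrease $c$ by $i$. A graph $G$ is reduced for $(c,k)$-LCP if no rule $R_{i,k}$ with $0\le i<c$ can be applied, i.e. $G$ contains no obstacle from $O_{i,k}$ for any $0\le i<c$. Kernel: $(2,k)$-Load Coloring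 admits a kernel with less than $s(k)$ edges if there is a polynomial-time algorithm mapping each instance $(G,k)$ to an instance $(G',k')$ of the same problem such that $G\in(2,k)$-LCP if and only if $G'\in(2,k')$-LCP, $k'\le g(k)$ and the size of $G'$ is at most $g(k)$ for some function $g$ of $k$ only, and $|E(G')|<s(k)$. -}

module Defs where

open import Data.Bool using (Bool; true; false; T; T?; if_then_else_)
open import Data.Fin using (Fin; toℕ; fromℕ<; remQuot)
import Data.Fin as Fin
import Data.Fin.Properties as Fin
open import Data.Fin.Subset using (Subset; _∈_; _⊆_; _∩_; _∪_; ∣_∣; Empty; Nonempty)
open import Data.List using (List; length; filter; allFin; cartesianProduct)
open import Data.Nat using (ℕ; zero; suc; _+_; _*_; _∸_; _^_; _≤_; _<_; _≡ᵇ_; _<?_)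
open import Data.Nat.Logarithm using (⌈log₂_⌉)
open import Data.Product using (Σ-syntax; ∃-syntax; _×_; _,_; uncurry)
open import Data.Vec using (tabulate)
open import Function.Bundles using (_⇔_)
open import Relation.Binary.PropositionalEquality using (_≡_; _≢_)
open import Relation.Nullary using (¬_; yes; no)
open import Relation.Nullary.Decidable using (_×-dec_)

record Graph (n : ℕ) : Set where
  field
    adj        : Fin n → Fin n → Bool
    adj-sym    : ∀ u v → adj u v ≡ adj v u
    adj-irrefl : ∀ v → adj v v ≡ false

open Graph public

N : ∀ {n} → Graph n → Fin n → Subset n
N G v = tabulate (adj G v)

-- Each edge is listed once, as the pair (u , v) with u < v.
edges : ∀ {n} → Graph n → List (Fin n × Fin n)
edges {n} G =
  filter (λ (u , v) → (u Fin.<? v) ×-dec T? (adj G u v))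
         (cartesianProduct (allFin n) (allFin n))

#edges : ∀ {n} → Graph n → ℕ
#edges G = length (edges G)

#monochromatic : ∀ {n c} → Graph n → (Fin n → Fin c) → Fin c → ℕ
#monochromatic G φ i =
  length (filter (λ (u , v) → (φ u Fin.≟ i) ×-dec (φ v Fin.≟ i)) (edges G))

LCP : (c k : ℕ) → ∀ {n} → Graph n → Set
LCP c k {n} G = Σ[ φ ∈ (Fin n → Fin c) ] (∀ i → k ≤ #monochromatic G φ i)

record Obstacle (i k : ℕ) {n : ℕ} (G : Graph n) (V₁ V₂ : Subset n) : Set where
  field
    disjoint    : Empty (V₁ ∩ V₂)
    nonempty    : Nonempty (V₁ ∪ V₂)
    card        : ∣ V₁ ∣ ≡ i
    N⊆V₁        : ∀ v → v ∈ V₂ → N G v ⊆ V₁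
    -- W u is the set V_u; its values outside V₁ are irrelevant.
    W           : Fin n → Subset n
    W⊆          : ∀ u → u ∈ V₁ → W u ⊆ (N G u ∩ V₂)
    W-large     : ∀ u → u ∈ V₁ → k ≤ ∣ W u ∣
    W-disjoint  : ∀ u v → u ∈ V₁ → v ∈ V₁ → u ≢ v → Empty (W u ∩ W v)

Reduced : (c k : ℕ) → ∀ {n} → Graph n → Set
Reduced c k {n} G = ∀ i → i < c → (V₁ V₂ : Subset n) → ¬ Obstacle i k G V₁ V₂

-- Random access machines, programmed in structured form.  The memory
-- consists of registers and of arrays, all holding natural numbers.

infixl 6 _⊕_ _⊖_
infix  5 _≔_ _⟦_⟧≔_
infixr 4 _⨾_

data Exp : Set where
  lit  : ℕ → Exp
  reg  : ℕ → Exp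
  _⟦_⟧ : ℕ → Exp → Exp
  _⊕_  : Exp → Exp → Exp
  _⊖_  : Exp → Exp → Exp

data Cmd : Set where
  skip          : Cmd
  _≔_           : ℕ → Exp → Cmd
  _⟦_⟧≔_        : ℕ → Exp → Exp → Cmd
  _⨾_           : Cmd → Cmd → Cmd
  If_Then_Else_ : Exp → Cmd → Cmd → Cmd
  While_Do_     : Exp → Cmd → Cmd

record Store : Set where
  constructor store
  field
    regs : ℕ → ℕ
    arrs : ℕ → ℕ → ℕ

open Store public

update : {A : Set} → (ℕ → A) → ℕ → A → ℕ → A
update f i x j = if j ≡ᵇ i then x else f j

setReg : Store → ℕ → ℕ → Store
setReg σ x m = store (update (regs σ) x m) (arrs σ)

setArr : Store → ℕ → ℕ → ℕ → Store
setArr σ a i m = store (regs σ) (update (arrs σ) a (update (arrs σ a) i m))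

⟦_⟧ : Exp → Store → ℕ
⟦ lit m ⟧   σ = m
⟦ reg x ⟧   σ = regs σ x
⟦ a ⟦ e ⟧ ⟧ σ = arrs σ a (⟦ e ⟧ σ)
⟦ d ⊕ e ⟧   σ = ⟦ d ⟧ σ + ⟦ e ⟧ σ
⟦ d ⊖ e ⟧   σ = ⟦ d ⟧ σ ∸ ⟦ e ⟧ σ

-- p ∣ σ ⇓ σ′ ∣ t : started in σ, the program p halts in σ′ after t steps.
-- Assignments and tests take one step each.  A program has finitely many
-- expressions, so charging for their evaluation would only change t by a
-- constant factor.  Multiplication is deliberately not a primitive: with
-- addition and truncated subtraction only, the bit length of the contents
-- of the memory grows by O(1) per step, so polynomially many steps here
-- means polynomial time on a Turing machine.
infix 3 _∣_⇓_∣_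

data _∣_⇓_∣_ : Cmd → Store → Store → ℕ → Set where
  ⇓skip : ∀ {σ} → skip ∣ σ ⇓ σ ∣ 0
  ⇓reg  : ∀ {σ x e} → (x ≔ e) ∣ σ ⇓ setReg σ x (⟦ e ⟧ σ) ∣ 1
  ⇓arr  : ∀ {σ a d e} →
          (a ⟦ d ⟧≔ e) ∣ σ ⇓ setArr σ a (⟦ d ⟧ σ) (⟦ e ⟧ σ) ∣ 1
  ⇓seq  : ∀ {p q σ σ′ σ″ s t} →
          p ∣ σ ⇓ σ′ ∣ s → q ∣ σ′ ⇓ σ″ ∣ t → (p ⨾ q) ∣ σ ⇓ σ″ ∣ s + t
  ⇓then : ∀ {e p q σ σ′ t} → ⟦ e ⟧ σ ≢ 0 →
          p ∣ σ ⇓ σ′ ∣ t → (If e Then p Else q) ∣ σ ⇓ σ′ ∣ suc t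
  ⇓else : ∀ {e p q σ σ′ t} → ⟦ e ⟧ σ ≡ 0 →
          q ∣ σ ⇓ σ′ ∣ t → (If e Then p Else q) ∣ σ ⇓ σ′ ∣ suc t
  ⇓exit : ∀ {e p σ} → ⟦ e ⟧ σ ≡ 0 → (While e Do p) ∣ σ ⇓ σ ∣ 1
  ⇓loop : ∀ {e p σ σ′ σ″ s t} → ⟦ e ⟧ σ ≢ 0 →
          p ∣ σ ⇓ σ′ ∣ s → (While e Do p) ∣ σ′ ⇓ σ″ ∣ t →
          (While e Do p) ∣ σ ⇓ σ″ ∣ suc (s + t)

record Instance : Set where
  field
    order   : ℕ
    graph   : Graph order
    param   : ℕ
    1≤param : 1 ≤ param

open Instance public

YesInstance : ℕ → Instance → Set
YesInstance c I = LCP c (param I) (graph I)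

-- The adjacency matrix in row-major order: the entry of (u , v) is stored
-- at n * u + v.
matrix : ∀ {n} → Graph n → Fin (n * n) → ℕ
matrix {n} G p = if uncurry (adj G) (remQuot n p) then 1 else 0

-- The input is in registers 0 (order) and 1 (parameter) and in array 0
-- (adjacency matrix); the rest of the memory is initially 0.
input : Instance → Store
input I = store inRegs inArrs
  where
  inRegs : ℕ → ℕ
  inRegs 0 = order I
  inRegs 1 = param I
  inRegs _ = 0

  inArrs : ℕ → ℕ → ℕ
  inArrs 0 p with p <? order I * order I
  ... | yes p<n² = matrix (graph I) (fromℕ< p<n²)
  ... | no  _    = 0
  inArrs _ _ = 0

-- The output is read off registers 2 and 3 and array 1.
record Output (σ : Store) (I : Instance) : Set where
  field
    out-order : regs σ 2 ≡ order I
    out-param : regs σ 3 ≡ param I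
    out-graph : ∀ p → arrs σ 1 (toℕ p) ≡ matrix (graph I) p

-- Number of bits of the input, with the parameter written in binary.
bits : Instance → ℕ
bits I = order I * order I + ⌈log₂ suc (param I) ⌉

PolynomialTime : (Instance → Instance) → Set
PolynomialTime f =
  Σ[ P ∈ Cmd ] ∃[ a ] ∃[ d ] ∀ I →
    ∃[ σ ] ∃[ t ] (P ∣ input I ⇓ σ ∣ t) × Output σ (f I) × t ≤ a * bits I ^ d

size : Instance → ℕ
size I = order I + #edges (graph I)

record Kernel (c : ℕ) (s : ℕ → ℕ) : Set where
  field
    kernelize  : Instance → Instance
    polytime   : PolynomialTime kernelize
    equivalent : ∀ I → YesInstance c I ⇔ YesInstance c (kernelize I)
    bound      : ℕ → ℕ
    param≤     : ∀ I → param (kernelize I) ≤ bound (param I)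
    size≤      : ∀ I → size (kernelize I) ≤ bound (param I)
    edges<     : ∀ I → #edges (graph (kernelize I)) < s (param I)

module Submission where

open import Defs
open import Data.Bool using (Bool; true; false; if_then_else_; _∧_; T; T?)
import Data.Bool.Properties as Bool
open import Data.Fin using (Fin; zero; suc; toℕ; fromℕ<; combine)
import Data.Fin as Fin
import Data.Fin.Properties as Fin
open import Data.Fin.Subset as Subset using (Subset; ⁅_⁆; ∣_∣)
open import Data.Fin.Subset.Properties using (∣⁅x⁆∣≡1; x∈⁅x⁆; x∈⁅y⁆⇒x≡y; x∈p∩q⁺; x∈p∩q⁻; p⊆p∪q)
open import Data.List
  using (List; []; _∷_; _++_; map; length; filter; cartesianProduct; allFin; tabulate; lookup; _∷ʳ_; take)
import Data.List.Membership.DecPropositional as DecMembership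
import Data.List.Membership.Propositional as List using (_∈_; find)
open import Data.List.Membership.Propositional.Properties using (∈-∃++; ∈-allFin; ∈-++⁻)
open import Data.List.Properties
  using (map-cong; map-++; map-∘; length-++; map-tabulate; tabulate-lookup; filter-++; filter-all;
    filter-≐; filter-accept; filter-reject; take-suc-tabulate; take-all; length-tabulate; ++-identityʳ;
    length-filter)
open import Data.List.Relation.Binary.Disjoint.Propositional using (Disjoint)
open import Data.List.Relation.Binary.Permutation.Propositional
  using (_↭_; ↭-refl; ↭-reflexive; ↭-sym; ↭-trans; prep; swap; ↭⇒↭ₛ)
open import Data.List.Relation.Binary.Permutation.Propositional.Properties
  using (map⁺; ∈-resp-↭; shift; ++⁺ˡ; ++⁺ʳ; ++-comm; ++-assoc; filter-↭)
import Data.List.Relation.Binary.Permutation.Setoid.Properties as ↭ₛ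
open import Data.List.Relation.Unary.All using (All; []; _∷_)
import Data.List.Relation.Unary.All as All
import Data.List.Relation.Unary.All.Properties as All
open import Data.List.Relation.Unary.AllPairs using (_∷_)
open import Data.List.Relation.Unary.Any using (here; there)
import Data.List.Relation.Unary.Any as List using (any?)
open import Data.List.Relation.Unary.Linked using (Linked; _∷_)
import Data.List.Relation.Unary.Linked as Linked
open import Data.List.Relation.Unary.Unique.Propositional using (Unique)
open import Data.List.Relation.Unary.Unique.Propositional.Properties using (allFin⁺)
import Data.List.Sort as Sort
open import Data.Nat
  using (ℕ; zero; suc; _+_; _*_; _∸_; _≤_; _<_; _≤?_; z≤n; s≤s; ⌈_/2⌉; ⌊_/2⌋; _<?_; _≡ᵇ_; _^_; _⊔_)
open import Data.Nat.ListAction using (sum)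
open import Data.Nat.ListAction.Properties using (sum-++; sum-↭)
open import Data.Nat.Logarithm using (⌈log₂_⌉; ⌈log₂⌉-mono-≤)
open import Data.Nat.Properties
open import Data.Nat.Tactic.RingSolver using (solve-∀)
open import Data.Product using (∃-syntax; _×_; _,_; proj₁; proj₂; uncurry)
import Data.Product as Product
open import Data.Sum using (_⊎_; inj₁; inj₂)
open import Data.Unit using (tt; ⊤)
import Data.Vec as Vec
import Data.Vec.Properties as Vec
open import Function using (_∘_; id)
open import Function.Bundles using (_⇔_; mk⇔)
open import Relation.Binary.Bundles using (DecTotalOrder)
import Relation.Binary.Construct.Flip.EqAndOrd as Flip
import Relation.Binary.Construct.On as On
open import Relation.Binary.Definitions using (tri<; tri≈; tri>)
open import Relation.Binary.PropositionalEquality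
  using (_≡_; refl; sym; trans; cong; cong₂; subst; subst₂; module ≡-Reasoning; setoid; _≢_)
open import Relation.Nullary using (Dec; yes; no; does; contradiction; ¬_; ¬?)
open import Relation.Nullary.Decidable using (_×-dec_; dec-true; dec-false; from-yes)
open import Relation.Unary using (Decidable)

-- Call a graph with m ≥ 8k edges robust if at least k edges avoid each vertex.
-- Since one of two colour classes avoids a given vertex, robustness is necessary
-- for membership in (2,k)-LCP; it is also sufficient.  Let v be a vertex of
-- degree d ≥ 2k.  If d ≥ 3k, then k edges avoiding v have at most 2k endpoints,
-- and k neighbours of v remain for the other class.  If d < 3k, then pair up 2k
-- neighbours of v and separate the members of each pair greedily: v has k
-- neighbours on either side, and one of the sides keeps k edges together with
-- the remaining vertices.  If all degrees are less than 2k, then pair up the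
-- vertices in the order of their degrees.  If 2k pairs are adjacent, they form a
-- matching that can be halved.  Otherwise separating the members of each pair
-- greedily keeps at least (m - 2k + 1)/2 edges, and the degree sums of the two
-- sides differ by less than 2k because the degrees are sorted.
--
-- A reduced graph with m ≥ 8k edges is robust: a vertex of degree at least 3k
-- has fewer than k pendant neighbours, hence more than 2k other neighbours, each
-- of which lies on an edge avoiding the vertex.  The kernelization removes the
-- isolated vertices if m < 8k, and otherwise decides the instance by testing
-- robustness.

-- A linear inequality follows from a nonnegative combination l ≤ r of other
-- ones once the slack e is exhibited; what is left is a semiring identity.
linear : ∀ {a b l r} e → l ≤ r → a + r + e ≡ b + l → a ≤ b
linear {a} {b} {l} {r} e l≤r eq = +-cancelʳ-≤ l a b (begin
  a + l     ≤⟨ +-monoʳ-≤ a l≤r ⟩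
  a + r     ≤⟨ m≤m+n (a + r) e ⟩
  a + r + e ≡⟨ eq ⟩
  b + l     ∎)
  where open ≤-Reasoning

bit : Bool → ℕ
bit b = if b then 1 else 0

bit-∧ : ∀ b c → bit (b ∧ c) ≡ bit b * bit c
bit-∧ true  c = sym (+-identityʳ (bit c))
bit-∧ false c = refl

bit-01 : ∀ b → bit b ≡ 0 ⊎ bit b ≡ 1
bit-01 true  = inj₂ refl
bit-01 false = inj₁ refl

-- Finite sums

module _ {A : Set} where

  ∑ : List A → (A → ℕ) → ℕ
  ∑ xs f = sum (map f xs)

  ∑-cong : ∀ {f g} xs → (∀ x → f x ≡ g x) → ∑ xs f ≡ ∑ xs g
  ∑-cong xs f≗g = cong sum (map-cong f≗g xs)

  ∑-++ : ∀ xs ys f → ∑ (xs ++ ys) f ≡ ∑ xs f + ∑ ys f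
  ∑-++ xs ys f = trans (cong sum (map-++ f xs ys)) (sum-++ (map f xs) (map f ys))

  ∑-↭ : ∀ {xs ys} f → xs ↭ ys → ∑ xs f ≡ ∑ ys f
  ∑-↭ f p = sum-↭ (map⁺ f p)

  ∑-mono : ∀ {f g} xs → (∀ x → f x ≤ g x) → ∑ xs f ≤ ∑ xs g
  ∑-mono []       f≤g = z≤n
  ∑-mono (x ∷ xs) f≤g = +-mono-≤ (f≤g x) (∑-mono xs f≤g)

  ∑-+ : ∀ xs f g → ∑ xs (λ x → f x + g x) ≡ ∑ xs f + ∑ xs g
  ∑-+ []       f g = refl
  ∑-+ (x ∷ xs) f g = trans (cong (f x + g x +_) (∑-+ xs f g)) (lemma (f x) (g x) (∑ xs f) (∑ xs g))
    where
    lemma : ∀ a b c d → a + b + (c + d) ≡ a + c + (b + d)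
    lemma = solve-∀

  ∑-*ˡ : ∀ c xs f → ∑ xs (λ x → c * f x) ≡ c * ∑ xs f
  ∑-*ˡ c []       f = sym (*-zeroʳ c)
  ∑-*ˡ c (x ∷ xs) f = trans (cong (c * f x +_) (∑-*ˡ c xs f)) (sym (*-distribˡ-+ c (f x) (∑ xs f)))

  ∑-0 : ∀ {f} xs → (∀ x → f x ≡ 0) → ∑ xs f ≡ 0
  ∑-0 []       f≗0 = refl
  ∑-0 (x ∷ xs) f≗0 = cong₂ _+_ (f≗0 x) (∑-0 xs f≗0)

  ∑-filter : ∀ {P : A → Set} (P? : Decidable P) xs f →
             ∑ (filter P? xs) f ≡ ∑ xs (λ x → bit (does (P? x)) * f x)
  ∑-filter P? []       f = refl
  ∑-filter P? (x ∷ xs) f with does (P? x)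
  ... | true  = cong₂ _+_ (sym (+-identityʳ (f x))) (∑-filter P? xs f)
  ... | false = ∑-filter P? xs f

  length-∑ : ∀ xs → length xs ≡ ∑ xs (λ _ → 1)
  length-∑ []       = refl
  length-∑ (x ∷ xs) = cong suc (length-∑ xs)

  ∑-∈ : ∀ {xs x} f → x List.∈ xs → f x ≤ ∑ xs f
  ∑-∈ {xs} {x} f x∈xs with ys , zs , refl ← ∈-∃++ x∈xs = begin
    f x                  ≤⟨ m≤m+n (f x) _ ⟩
    f x + ∑ (ys ++ zs) f ≡⟨ ∑-↭ f (shift x ys zs) ⟨
    ∑ (ys ++ x ∷ zs) f   ∎
    where open ≤-Reasoning

∑-swap : ∀ {A B : Set} (xs : List A) (ys : List B) (f : A → B → ℕ) →
         ∑ xs (λ x → ∑ ys (f x)) ≡ ∑ ys (λ y → ∑ xs (λ x → f x y))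
∑-swap []       ys f = sym (∑-0 ys (λ _ → refl))
∑-swap (x ∷ xs) ys f =
  trans (cong (∑ ys (f x) +_) (∑-swap xs ys f)) (sym (∑-+ ys (f x) (λ y → ∑ xs (λ z → f z y))))

∑-map : ∀ {A B : Set} (g : A → B) xs f → ∑ (map g xs) f ≡ ∑ xs (f ∘ g)
∑-map g xs f = cong sum (sym (map-∘ xs))

∑-cartesianProduct : ∀ {A B : Set} (xs : List A) (ys : List B) (f : A × B → ℕ) →
                     ∑ (cartesianProduct xs ys) f ≡ ∑ xs (λ x → ∑ ys (λ y → f (x , y)))
∑-cartesianProduct []       ys f = refl
∑-cartesianProduct (x ∷ xs) ys f = trans (∑-++ (map (x ,_) ys) _ f)
  (cong₂ _+_ (∑-map (x ,_) ys f) (∑-cartesianProduct xs ys f))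

∈⇒↭∷ : ∀ {A : Set} {xs : List A} {x} → x List.∈ xs → ∃[ ys ] xs ↭ x ∷ ys
∈⇒↭∷ {x = x} x∈xs with ys , zs , refl ← ∈-∃++ x∈xs = ys ++ zs , shift x ys zs

-- Splitting a vertex list into two parts with k edges each

module Weighted {V : Set} (a : V → V → ℕ) (a-01 : ∀ u v → a u v ≡ 0 ⊎ a u v ≡ 1)
                (a-sym : ∀ u v → a u v ≡ a v u) (a-irrefl : ∀ v → a v v ≡ 0) where

  -- On lists without repetitions, row x Y is the number of neighbours of x in
  -- Y, E X Y the number of adjacent pairs in X × Y and e X the number of edges
  -- inside X.
  row : V → List V → ℕ
  row x Y = ∑ Y (a x)

  E : List V → List V → ℕ
  E X Y = ∑ X (λ x → row x Y)

  e : List V → ℕ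
  e []      = 0
  e (x ∷ X) = row x X + e X

  row-++ : ∀ x Y Z → row x (Y ++ Z) ≡ row x Y + row x Z
  row-++ x Y Z = ∑-++ Y Z (a x)

  row-↭ : ∀ x {Y Z} → Y ↭ Z → row x Y ≡ row x Z
  row-↭ x = ∑-↭ (a x)

  a≤1 : ∀ u v → a u v ≤ 1
  a≤1 u v with a-01 u v
  ... | inj₁ eq = ≤-trans (≤-reflexive eq) z≤n
  ... | inj₂ eq = ≤-reflexive eq

  row≤length : ∀ x Y → row x Y ≤ length Y
  row≤length x Y = ≤-trans (∑-mono Y (a≤1 x)) (≤-reflexive (sym (length-∑ Y)))

  E-++ˡ : ∀ X Y Z → E (X ++ Y) Z ≡ E X Z + E Y Z
  E-++ˡ X Y Z = ∑-++ X Y (λ x → row x Z)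

  E-++ʳ : ∀ X Y Z → E X (Y ++ Z) ≡ E X Y + E X Z
  E-++ʳ X Y Z = trans (∑-cong X (λ x → row-++ x Y Z)) (∑-+ X (λ x → row x Y) (λ x → row x Z))

  E-comm : ∀ X Y → E X Y ≡ E Y X
  E-comm X Y = trans (∑-swap X Y a) (∑-cong Y (λ y → ∑-cong X (λ x → a-sym x y)))

  E-↭ˡ : ∀ {X Y} Z → X ↭ Y → E X Z ≡ E Y Z
  E-↭ˡ Z = ∑-↭ (λ x → row x Z)

  E-↭ʳ : ∀ X {Y Z} → Y ↭ Z → E X Y ≡ E X Z
  E-↭ʳ X p = ∑-cong X (λ x → row-↭ x p)

  -- The handshake identity. It turns the recursively defined `e` into a sum over ordered pairs,
  -- from which invariance under permutation (`e-↭`) is immediate.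
  2e≡E : ∀ X → 2 * e X ≡ E X X
  2e≡E []      = refl
  2e≡E (x ∷ X) = begin
    2 * (row x X + e X)                   ≡⟨ lemma (row x X) (e X) ⟩
    row x X + (row x X + 2 * e X)         ≡⟨ cong₂ (λ s t → row x X + (s + t)) (∑-cong X (a-sym x)) (2e≡E X) ⟩
    row x X + (∑ X (λ y → a y x) + E X X) ≡⟨ cong (row x X +_) (∑-+ X (λ y → a y x) (λ y → row y X)) ⟨
    row x X + E X (x ∷ X)                 ≡⟨ cong (λ s → s + row x X + E X (x ∷ X)) (a-irrefl x) ⟨
    E (x ∷ X) (x ∷ X)                     ∎
    where
    open ≡-Reasoning
    lemma : ∀ r s → 2 * (r + s) ≡ r + (r + 2 * s)
    lemma = solve-∀

  e-↭ : ∀ {X Y} → X ↭ Y → e X ≡ e Y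
  e-↭ {X} {Y} p = *-cancelˡ-≡ (e X) (e Y) 2 (begin
    2 * e X ≡⟨ 2e≡E X ⟩
    E X X   ≡⟨ E-↭ˡ X p ⟩
    E Y X   ≡⟨ E-↭ʳ Y p ⟩
    E Y Y   ≡⟨ 2e≡E Y ⟨
    2 * e Y ∎)
    where open ≡-Reasoning

  e-++ : ∀ X Y → e (X ++ Y) ≡ e X + e Y + E X Y
  e-++ []      Y = sym (+-identityʳ (e Y))
  e-++ (x ∷ X) Y = trans (cong₂ _+_ (row-++ x X Y) (e-++ X Y)) (lemma (row x X) (row x Y) (e X) (e Y) (E X Y))
    where
    lemma : ∀ r s t u v → r + s + (t + u + v) ≡ r + t + u + (s + v)
    lemma = solve-∀

  eˡ≤e-++ : ∀ X Y → e X ≤ e (X ++ Y)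
  eˡ≤e-++ X Y = begin
    e X                 ≤⟨ m≤m+n (e X) (e Y + E X Y) ⟩
    e X + (e Y + E X Y) ≡⟨ +-assoc (e X) (e Y) (E X Y) ⟨
    e X + e Y + E X Y   ≡⟨ e-++ X Y ⟨
    e (X ++ Y)          ∎
    where open ≤-Reasoning

  -- Collecting k edges on at most 2k vertices

  pick : ∀ x s Y → s ≤ row x Y → ∃[ D ] ∃[ T ] Y ↭ D ++ T × length D ≡ s × row x D ≡ s
  pick x zero    Y       _  = [] , Y , ↭-refl , refl , refl
  pick x (suc s) (y ∷ Y) s≤ with a x y in eq | a-01 x y
  ... | _ | inj₁ refl with D , T , p , |D|≡ , row≡ ← pick x (suc s) Y s≤ =
    D , y ∷ T , ↭-trans (prep y p) (↭-sym (shift y D T)) , |D|≡ , row≡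
  ... | _ | inj₂ refl with D , T , p , |D|≡ , row≡ ← pick x s Y (≤-pred s≤) =
    y ∷ D , T , prep y p , cong suc |D|≡ , trans (cong (_+ row x D) eq) (cong suc row≡)

  -- The m edges inside `B` cost at most 2m vertices. The missing r + 1 edges are taken at `x`: as
  -- far as its neighbours in `B` do not supply them, neighbours in `C` are moved over. This adds at
  -- most r + 2 ≤ 2(r + 1) vertices.
  extend : ∀ x X m r {B C} → X ↭ B ++ C → m ≤ e B → length B ≤ 2 * m → suc m + r ≤ row x X + m →
           ∃[ B′ ] ∃[ C′ ] x ∷ X ↭ B′ ++ C′ × suc m + r ≤ e B′ × length B′ ≤ 2 * (suc m + r)
  extend x X m r {B} {C} p m≤eB |B|≤ k≤ =
    let D , T , q , |D|≡ , row≡ = pick x (suc r ∸ row x B) C (m≤n+o⇒m∸n≤o (suc r) (row x B) enough)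
    in x ∷ D ++ B , T , perm {D} q , many {D} row≡ , few {D} |D|≡
    where
    open ≤-Reasoning
    enough : suc r ≤ row x B + row x C
    enough = linear 0 k≤ (trans (cong (λ s → suc r + (s + m) + 0) (trans (row-↭ x p) (row-++ x B C)))
      (lemma r (row x B + row x C) m))
      where
      lemma : ∀ r s m → suc r + (s + m) + 0 ≡ s + (suc m + r)
      lemma = solve-∀
    perm : ∀ {D T} → C ↭ D ++ T → x ∷ X ↭ (x ∷ D ++ B) ++ T
    perm {D} {T} q = prep x (↭-trans p (↭-trans (++⁺ˡ B q)
      (↭-trans (↭-sym (++-assoc B D T)) (++⁺ʳ T (++-comm B D)))))
    many : ∀ {D} → row x D ≡ suc r ∸ row x B → suc m + r ≤ row x (D ++ B) + e (D ++ B)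
    many {D} row≡ = begin
      suc m + r                         ≡⟨ +-suc m r ⟨
      m + suc r                         ≡⟨ +-comm m (suc r) ⟩
      suc r + m                         ≤⟨ +-mono-≤ (m≤n+m∸n (suc r) (row x B)) m≤eB ⟩
      row x B + (suc r ∸ row x B) + e B ≡⟨ cong (λ s → row x B + s + e B) row≡ ⟨
      row x B + row x D + e B           ≡⟨ cong (_+ e B) (row-++ x B D) ⟨
      row x (B ++ D) + e B              ≤⟨ +-monoʳ-≤ (row x (B ++ D)) (eˡ≤e-++ B D) ⟩
      row x (B ++ D) + e (B ++ D)       ≡⟨ cong₂ _+_ (row-↭ x (++-comm B D)) (e-↭ (++-comm B D)) ⟩
      row x (D ++ B) + e (D ++ B)       ∎
    few : ∀ {D} → length D ≡ suc r ∸ row x B → length (x ∷ D ++ B) ≤ 2 * (suc m + r)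
    few {D} |D|≡ = begin
      suc (length (D ++ B))       ≡⟨ cong suc (length-++ D) ⟩
      suc (length D + length B)   ≤⟨ s≤s (+-mono-≤ (≤-trans (≤-reflexive |D|≡) (m∸n≤m (suc r) (row x B))) |B|≤) ⟩
      suc (suc r + 2 * m)         ≤⟨ m≤m+n _ r ⟩
      suc (suc r + 2 * m) + r     ≡⟨ lemma r m ⟩
      2 * (suc m + r)             ∎
      where
      lemma : ∀ r m → suc (suc r + 2 * m) + r ≡ 2 * (suc m + r)
      lemma = solve-∀

  -- Vertices are dropped from the front as long as k edges remain. The first vertex `x` that cannot
  -- be dropped supplies the edges that the rest lacks.
  compact : ∀ k X → k ≤ e X → ∃[ B ] ∃[ C ] X ↭ B ++ C × k ≤ e B × length B ≤ 2 * k
  compact zero []      _  = [] , [] , ↭-refl , z≤n , z≤n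
  compact k    (x ∷ X) k≤ with k ≤? e X
  ... | yes k≤e with B , C , p , k≤eB , |B|≤ ← compact k X k≤e =
    B , x ∷ C , ↭-trans (prep x p) (↭-sym (shift x B C)) , k≤eB , |B|≤
  ... | no k≰e
    -- The recursion asks for all `e X` edges of the rest, which are fewer than k; `x` then has to
    -- contribute exactly the difference `suc r`.
    with B , C , p , m≤eB , |B|≤ ← compact (e X) X ≤-refl
    with r , refl ← m≤n⇒∃[o]m+o≡n (≰⇒> k≰e)
    = extend x X (e X) r {B} p m≤eB |B|≤ k≤

  -- The list is read as consecutive pairs, and the members of each pair are
  -- sent to different sides.
  data Split : List V → List V → List V → Set where
    []    : Split [] [] []
    [_]   : ∀ x → Split (x ∷ []) (x ∷ []) []
    left  : ∀ {L A B} x y → Split L A B → Split (x ∷ y ∷ L) (x ∷ A) (y ∷ B)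
    right : ∀ {L A B} x y → Split L A B → Split (x ∷ y ∷ L) (y ∷ A) (x ∷ B)

  split-↭ : ∀ {L A B} → Split L A B → L ↭ A ++ B
  split-↭ []                        = ↭-refl
  split-↭ [ x ]                     = ↭-refl
  split-↭ (left  {A = A} {B} x y s) = prep x (↭-trans (prep y (split-↭ s)) (↭-sym (shift y A B)))
  split-↭ (right {A = A} {B} x y s) =
    ↭-trans (swap x y (split-↭ s)) (prep y (↭-sym (shift x A B)))

  split-length : ∀ {L A B} → Split L A B → length A ≤ ⌈ length L /2⌉ × length B ≤ ⌈ length L /2⌉
  split-length []            = z≤n , z≤n
  split-length [ x ]         = s≤s z≤n , z≤n
  split-length (left  x y s) with |A|≤ , |B|≤ ← split-length s = s≤s |A|≤ , s≤s |B|≤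
  split-length (right x y s) with |A|≤ , |B|≤ ← split-length s = s≤s |A|≤ , s≤s |B|≤

  -- These edges form a matching, and every `Split` cuts all of them whatever the choices: they are
  -- the error term in `greedy` and the resource in `matching-halves`.
  paired : List V → ℕ
  paired (x ∷ y ∷ L) = a x y + paired L
  paired _           = 0

  paired≤ : ∀ L → paired L ≤ ⌊ length L /2⌋
  paired≤ []          = z≤n
  paired≤ (x ∷ [])    = z≤n
  paired≤ (x ∷ y ∷ L) = +-mono-≤ (a≤1 x y) (paired≤ L)

  paired≤e : ∀ L → paired L ≤ e L
  paired≤e []          = z≤n
  paired≤e (x ∷ [])    = z≤n
  paired≤e (x ∷ y ∷ L) = +-mono-≤ (m≤m+n (a x y) (row x L)) (≤-trans (paired≤e L) (m≤n+m (e L) (row y L)))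

  greedy-step : ∀ x y L A B → L ↭ A ++ B → row x B + row y A ≤ row x A + row y B →
                e L ≤ 2 * (e A + e B) + paired L →
                e (x ∷ y ∷ L) ≤ 2 * (e (x ∷ A) + e (y ∷ B)) + paired (x ∷ y ∷ L)
  greedy-step x y L A B p h e≤
    rewrite trans (row-↭ x p) (row-++ x A B) | trans (row-↭ y p) (row-++ y A B) =
    linear 0 (+-mono-≤ h e≤)
      (lemma (a x y) (row x A) (row x B) (row y A) (row y B) (e L) (e A) (e B) (paired L))
    where
    lemma : ∀ c xA xB yA yB l A B p → c + (xA + xB) + (yA + yB + l) + (xA + yB + (2 * (A + B) + p)) + 0
                                    ≡ 2 * (xA + A + (yB + B)) + (c + p) + (xB + yA + l)
    lemma = solve-∀

  -- Of the two ways to distribute x and y, one keeps at least half of the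
  -- edges from {x , y} to the vertices distributed before.
  greedy : ∀ L → ∃[ A ] ∃[ B ] Split L A B × e L ≤ 2 * (e A + e B) + paired L
  greedy []          = [] , [] , [] , z≤n
  greedy (x ∷ [])    = x ∷ [] , [] , [ x ] , z≤n
  greedy (x ∷ y ∷ L) with A , B , s , e≤ ← greedy L with ≤-total (row x B + row y A) (row x A + row y B)
  ... | inj₁ h = x ∷ A , y ∷ B , left x y s , greedy-step x y L A B (split-↭ s) h e≤
  ... | inj₂ h = y ∷ A , x ∷ B , right x y s ,
    subst (λ t → e (x ∷ y ∷ L) ≤ 2 * t + paired (x ∷ y ∷ L)) (+-comm (e (x ∷ B)) (e (y ∷ A)))
      (greedy-step x y L B A (↭-trans (split-↭ s) (++-comm A B)) h
        (subst (λ t → e L ≤ 2 * t + paired L) (+-comm (e A) (e B)) e≤))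

  balance-step : ∀ {x y z A B} → x ≤ z → y ≤ x → A ≤ B + y → B ≤ A + y →
                 x + A ≤ y + B + z × y + B ≤ x + A + z
  balance-step {x} {y} {z} {A} {B} x≤z y≤x A≤ B≤ =
    linear 0 (+-mono-≤ A≤ x≤z) (lemma₁ x y z A B) ,
    linear 0 (+-mono-≤ B≤ (+-mono-≤ y≤x (≤-trans y≤x x≤z))) (lemma₂ x y z A B)
    where
    lemma₁ : ∀ x y z A B → x + A + (B + y + z) + 0 ≡ y + B + z + (A + x)
    lemma₁ = solve-∀
    lemma₂ : ∀ x y z A B → y + B + (A + y + (x + z)) + 0 ≡ x + A + z + (B + (y + y))
    lemma₂ = solve-∀

  -- For successive pairs x, y the intervals from `d y` to `d x` do not overlap and lie below `d z`.
  -- Each pair shifts the difference of the two sums by the length of its interval, so with any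
  -- choice of signs the total stays within `d z`.
  balanced : ∀ (d : V → ℕ) {z L A B} → Split L A B → Linked (λ x y → d y ≤ d x) (z ∷ L) →
             ∑ A d ≤ ∑ B d + d z × ∑ B d ≤ ∑ A d + d z
  balanced d []     _             = z≤n , z≤n
  balanced d [ x ]  (dx≤dz ∷ _)   = ≤-trans (≤-reflexive (+-identityʳ (d x))) dx≤dz , z≤n
  balanced d {z} (left {A = A} {B} x y s) (dx≤dz ∷ dy≤dx ∷ l) with A≤ , B≤ ← balanced d s l =
    balance-step dx≤dz dy≤dx A≤ B≤
  balanced d {z} (right {A = A} {B} x y s) (dx≤dz ∷ dy≤dx ∷ l) with A≤ , B≤ ← balanced d s l =
    Product.swap (balance-step dx≤dz dy≤dx B≤ A≤)

  -- Halving by a matching, a star, a neighbourhood or sorted degrees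

  Halves : ℕ → List V → Set
  Halves k L = ∃[ A ] ∃[ B ] L ↭ A ++ B × k ≤ e A × k ≤ e B

  -- The list is cut right after its k-th adjacent pair, so that no pair is torn apart and the
  -- remaining l adjacent pairs lie in the suffix.
  matching-halves : ∀ k l L → k + l ≤ paired L → ∃[ A ] ∃[ B ] L ≡ A ++ B × k ≤ e A × l ≤ e B
  matching-halves zero    l L           h = [] , L , refl , z≤n , ≤-trans h (paired≤e L)
  matching-halves (suc k) l (x ∷ y ∷ L) h with a x y in eq | a-01 x y
  ... | _ | inj₁ refl with A , B , refl , k≤ , l≤ ← matching-halves (suc k) l L h =
    x ∷ y ∷ A , B , refl ,
    ≤-trans k≤ (≤-trans (m≤n+m (e A) (row y A)) (m≤n+m (row y A + e A) (a x y + row x A))) , l≤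
  ... | _ | inj₂ refl with A , B , refl , k≤ , l≤ ← matching-halves k l L (≤-pred h) =
    x ∷ y ∷ A , B , refl ,
    ≤-trans (s≤s k≤) (≤-trans (≤-reflexive (cong (_+ e A) (sym eq)))
      (+-mono-≤ (m≤m+n (a x y) (row x A)) (m≤n+m (e A) (row y A)))) , l≤

  -- `compact` confines k edges avoiding `v` to at most 2k vertices; at least 3k - 2k neighbours are
  -- left to form a star around `v`.
  star-halves : ∀ {k v X L} → L ↭ v ∷ X → k ≤ e X → 3 * k ≤ row v L → Halves k L
  star-halves {k} {v} {X} {L} p k≤eX 3k≤d with B , C , q , k≤eB , |B|≤ ← compact k X k≤eX =
    B , v ∷ C , ↭-trans p (↭-trans (prep v q) (↭-sym (shift v B C))) , k≤eB ,
    ≤-trans (linear 0 (+-mono-≤ 3k≤d (≤-trans (row≤length v B) |B|≤)) eq) (m≤m+n (row v C) (e C))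
    where
    d≡ : row v L ≡ row v B + row v C
    d≡ = begin
      row v L             ≡⟨ row-↭ v p ⟩
      a v v + row v X     ≡⟨ cong (_+ row v X) (a-irrefl v) ⟩
      row v X             ≡⟨ row-↭ v q ⟩
      row v (B ++ C)      ≡⟨ row-++ v B C ⟩
      row v B + row v C   ∎
      where open ≡-Reasoning
    lemma : ∀ k b c → k + (b + c + 2 * k) + 0 ≡ c + (3 * k + b)
    lemma = solve-∀
    eq : k + (row v L + 2 * k) + 0 ≡ row v C + (3 * k + row v B)
    eq = trans (cong (λ d → k + (d + 2 * k) + 0) d≡) (lemma k (row v B) (row v C))

  larger-half : ∀ {k m n} → 2 * k ≤ m + n → k ≤ m ⊎ k ≤ n
  larger-half {k} {m} {n} h with k ≤? m | k ≤? n
  ... | yes k≤m | _       = inj₁ k≤m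
  ... | no _    | yes k≤n = inj₂ k≤n
  ... | no k≰m  | no k≰n  = contradiction (begin-strict
    m + n <⟨ +-mono-< (≰⇒> k≰m) (≰⇒> k≰n) ⟩
    k + k ≡⟨ cong (k +_) (+-identityʳ k) ⟨
    2 * k ∎) (≤⇒≯ h)
    where open ≤-Reasoning

  -- 2k neighbours D of v are shared out evenly between the two sides, v joins
  -- one of them and all remaining vertices T the other.
  neighbours-halves : ∀ {k v X L} → L ↭ v ∷ X → 8 * k ≤ e L → 2 * k ≤ row v X → row v X ≤ 3 * k → Halves k L
  neighbours-halves {k} {v} {X} {L} p 8k≤ 2k≤d d≤3k
    with D , T , q , |D|≡ , rowD≡ ← pick v (2 * k) X 2k≤d
    with A , B , s , eD≤ ← greedy D =
    choose (larger-half (*-cancelˡ-≤ 2 sum≥))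
    where
    |D|/2≡k : ⌈ length D /2⌉ ≡ k
    |D|/2≡k = trans (cong ⌈_/2⌉ (trans |D|≡ (cong (k +_) (+-identityʳ k)))) (sym (n≡⌈n+n/2⌉ k))

    paired≤k : paired D ≤ k
    paired≤k = ≤-trans (paired≤ D) (≤-trans (⌊n/2⌋≤⌈n/2⌉ (length D)) (≤-reflexive |D|/2≡k))

    eL≡ : e L ≡ row v X + (e D + e T + (E A T + E B T))
    eL≡ = trans (e-↭ p) (cong (row v X +_) (begin
      e X                             ≡⟨ e-↭ q ⟩
      e (D ++ T)                      ≡⟨ e-++ D T ⟩
      e D + e T + E D T               ≡⟨ cong (e D + e T +_) (E-↭ˡ T (split-↭ s)) ⟩
      e D + e T + E (A ++ B) T        ≡⟨ cong (e D + e T +_) (E-++ˡ A B T) ⟩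
      e D + e T + (E A T + E B T)     ∎))
      where open ≡-Reasoning

    -- Of the 8k edges, at most 3k are at `v` and at most k join paired vertices of `D`. At least
    -- half of the other edges inside `D` survive in `A` or `B`, and every edge meeting `T` but not
    -- `v` survives in at least one of the two candidates. Hence these have at least 4k/2 edges in
    -- total, and one of them has k.
    sum≥ : 2 * (2 * k) ≤ 2 * (e (A ++ T) + e (B ++ T))
    sum≥ rewrite e-++ A T | e-++ B T =
      linear (3 * e T + (E A T + E B T))
        (+-mono-≤ (≤-trans 8k≤ (≤-reflexive eL≡)) (+-mono-≤ d≤3k (+-mono-≤ eD≤ paired≤k)))
        (lemma k (row v X) (e D) (e T) (e A) (e B) (E A T) (E B T) (paired D))
      where
      lemma : ∀ k d D T A B AT BT p →
              2 * (2 * k) + (d + (D + T + (AT + BT)) + (3 * k + (2 * (A + B) + p + k))) + (3 * T + (AT + BT))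
              ≡ 2 * (A + T + AT + (B + T + BT)) + (8 * k + (d + (D + p)))
      lemma = solve-∀

    -- At most `length A` ≤ k of the 2k neighbours of `v` in `D` lie in `A`, so at least k lie in
    -- `B`.
    half : ∀ A B → D ↭ A ++ B → length A ≤ ⌈ length D /2⌉ → k ≤ e (v ∷ B)
    half A B r |A|≤ = ≤-trans (linear 0 (≤-trans (row≤length v A) (≤-trans |A|≤ (≤-reflexive |D|/2≡k)))
      (begin
        k + k + 0         ≡⟨ +-assoc k k 0 ⟩
        2 * k             ≡⟨ rowD≡ ⟨
        row v D           ≡⟨ row-↭ v r ⟩
        row v (A ++ B)    ≡⟨ row-++ v A B ⟩
        row v A + row v B ≡⟨ +-comm (row v A) (row v B) ⟩
        row v B + row v A ∎))
      (m≤m+n (row v B) (e B))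
      where open ≡-Reasoning

    halves : ∀ {A B} → D ↭ A ++ B → L ↭ (A ++ T) ++ v ∷ B
    halves {A} {B} r = ↭-trans p (↭-trans (prep v (↭-trans q (↭-trans (++⁺ʳ T r) (↭-trans (++-assoc A B T)
      (↭-trans (++⁺ˡ A (++-comm B T)) (↭-sym (++-assoc A T B))))))) (↭-sym (shift v (A ++ T) B)))

    choose : k ≤ e (A ++ T) ⊎ k ≤ e (B ++ T) → Halves k L
    choose (inj₁ h) = A ++ T , v ∷ B , halves (split-↭ s) , h , half A B (split-↭ s) (proj₁ (split-length s))
    choose (inj₂ h) = B ++ T , v ∷ A , halves r , h , half B A r (proj₂ (split-length s))
      where r = ↭-trans (split-↭ s) (++-comm A B)

  -- The degree sum of `A` is `2 * e A + E A B`, and likewise for `B`. The cut cancels in the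
  -- difference, so balanced degree sums mean that `e A` and `e B` are close.
  sorted-halves : ∀ {k z L} → Linked (λ x y → row y L ≤ row x L) (z ∷ L) → row z L < 2 * k → 8 * k ≤ e L →
                  Halves k L
  sorted-halves {k} {z} {L} l dz<2k 8k≤ with k + k ≤? paired L
  ... | yes k+k≤ with A , B , L≡ , k≤A , k≤B ← matching-halves k k L k+k≤ =
    A , B , ↭-reflexive L≡ , k≤A , k≤B
  ... | no k+k≰ with A , B , s , e≤ ← greedy L with A≤ , B≤ ← balanced (λ x → row x L) s l =
    A , B , p , half e≤ (subst₂ _≤_ B≡ (cong (_+ row z L) A≡) B≤) ,
    half (subst (λ t → e L ≤ 2 * t + paired L) (+-comm (e A) (e B)) e≤) (subst₂ _≤_ A≡ (cong (_+ row z L) B≡) A≤)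
    where
    p = split-↭ s
    A≡ : E A L ≡ 2 * e A + E A B
    A≡ = trans (E-↭ʳ A p) (trans (E-++ʳ A A B) (cong (_+ E A B) (sym (2e≡E A))))
    B≡ : E B L ≡ 2 * e B + E A B
    B≡ = trans (E-↭ʳ B p) (trans (E-++ʳ B A B)
      (trans (+-comm (E B A) (E B B)) (cong₂ _+_ (sym (2e≡E B)) (E-comm B A))))
    -- With at most 2k - 1 adjacent pairs, 2(x + y) ≥ 6k + 1; the balance gives 2x - 2y ≥ -(2k - 1).
    -- Adding up, 4x ≥ 4k + 2, whence the slack 2.
    half : ∀ {x y} → e L ≤ 2 * (x + y) + paired L → 2 * y + E A B ≤ 2 * x + E A B + row z L → k ≤ x
    half {x} {y} e≤ y≤ = *-cancelˡ-≤ 4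
      (linear 2 (+-mono-≤ (≤-trans 8k≤ e≤) (+-mono-≤ (≰⇒> k+k≰) (+-mono-≤ y≤ dz<2k)))
        (lemma k x y (paired L) (E A B) (row z L)))
      where
      lemma : ∀ k x y p c z → 4 * k + (2 * (x + y) + p + (k + k + (2 * x + c + z + 2 * k))) + 2
                            ≡ 4 * x + (8 * k + (suc p + (2 * y + c + suc z)))
      lemma = solve-∀

  -- The order is flipped because `balanced` expects degrees that do not increase along the list.
  degreeOrder : List V → DecTotalOrder _ _ _
  degreeOrder L = On.decTotalOrder (Flip.decTotalOrder ≤-decTotalOrder) (λ v → row v L)

  low-degree-halves : ∀ {k L} → 8 * k ≤ e L → All (λ v → row v L < 2 * k) L → Halves k L
  low-degree-halves {k} {L} 8k≤ low = go (sort L) (sort-↭ L) (sort-↗ L)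
    where
    open Sort (degreeOrder L) using (sort; sort-↭; sort-↗)
    go : ∀ S → S ↭ L → Linked (λ x y → row y L ≤ row x L) S → Halves k L
    go []      p _ = [] , [] , ↭-sym p , k≤0 , k≤0
      where k≤0 = ≤-trans (m≤n*m k 8) (≤-trans 8k≤ (≤-reflexive (sym (e-↭ p))))
    go (z ∷ S) p l =
      -- The first vertex of the sorted list is also put in front of it, as the vertex `z` whose
      -- degree bounds the imbalance.
      let A , B , q , h = sorted-halves {k} (≤-refl ∷ Linked.map (λ {x} {y} → subst₂ _≤_ (row≡ y) (row≡ x)) l)
            (subst (_< 2 * k) (row≡ z) (All.lookup low (∈-resp-↭ p (here refl))))
            (subst (8 * k ≤_) (e-↭ (↭-sym p)) 8k≤)
      in A , B , ↭-trans (↭-sym p) q , h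
      where
      row≡ : ∀ x → row x L ≡ row x (z ∷ S)
      row≡ x = row-↭ x (↭-sym p)

  delete-vertex : ∀ {v X L} → L ↭ v ∷ X → e L ≡ row v L + e X
  delete-vertex {v} {X} p = trans (e-↭ p)
    (cong (_+ e X) (trans (cong (_+ row v X) (sym (a-irrefl v))) (sym (row-↭ v p))))

  -- The second hypothesis is robustness without subtraction: by `delete-vertex`, `e L` exceeds
  -- `row v L` by the number of edges avoiding `v`.
  halves : ∀ {k L} → 8 * k ≤ e L → (∀ {v} → v List.∈ L → row v L + k ≤ e L) → Halves k L
  halves {k} {L} 8k≤ rest≥k with List.any? (λ v → 2 * k ≤? row v L) L
  ... | no ∄high = low-degree-halves 8k≤ (All.map ≰⇒> (All.¬Any⇒All¬ L ∄high))
  ... | yes ∃high with v , v∈L , 2k≤d ← List.find ∃high with X , p ← ∈⇒↭∷ v∈L with 3 * k ≤? row v L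
  ... | yes 3k≤d = star-halves p
    (+-cancelˡ-≤ (row v L) _ _ (≤-trans (rest≥k v∈L) (≤-reflexive (delete-vertex p)))) 3k≤d
  ... | no 3k≰d = neighbours-halves p 8k≤ (subst (2 * k ≤_) d≡ 2k≤d) (subst (_≤ 3 * k) d≡ (<⇒≤ (≰⇒> 3k≰d)))
    where
    d≡ : row v L ≡ row v X
    d≡ = trans (row-↭ v p) (cong (_+ row v X) (a-irrefl v))

-- Load colourings of graphs

module _ {A : Set} where

  filter-↭-++ : ∀ {P : A → Set} (P? : Decidable P) xs → xs ↭ filter P? xs ++ filter (¬? ∘ P?) xs
  filter-↭-++ P? []       = ↭-refl
  filter-↭-++ P? (x ∷ xs) with does (P? x)
  ... | true  = prep x (filter-↭-++ P? xs)
  ... | false = ↭-trans (prep x (filter-↭-++ P? xs)) (↭-sym (shift x (filter P? xs) (filter (¬? ∘ P?) xs)))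

  map-filter : ∀ {B : Set} {P : B → Set} (P? : Decidable P) (f : A → B) xs →
               map f (filter (P? ∘ f) xs) ≡ filter P? (map f xs)
  map-filter P? f []       = refl
  map-filter P? f (x ∷ xs) with does (P? (f x))
  ... | true  = cong (f x ∷_) (map-filter P? f xs)
  ... | false = map-filter P? f xs

  length-filter-∑ : ∀ {P : A → Set} (P? : Decidable P) xs → length (filter P? xs) ≡ ∑ xs (λ x → bit (does (P? x)))
  length-filter-∑ P? xs =
    trans (length-∑ (filter P? xs)) (trans (∑-filter P? xs (λ _ → 1)) (∑-cong xs (λ x → *-identityʳ _)))

  Unique⇒Disjoint : ∀ {xs ys : List A} → Unique (xs ++ ys) → Disjoint xs ys
  Unique⇒Disjoint {x ∷ xs} (x∉ ∷ u) (here refl , x∈ys) = All.lookup (All.++⁻ʳ xs x∉) x∈ys refl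
  Unique⇒Disjoint {x ∷ xs} (x∉ ∷ u) (there z∈xs , z∈ys) = Unique⇒Disjoint u (z∈xs , z∈ys)

-- Every edge is counted once in edges, but twice in a sum over ordered pairs.
double-∑-< : ∀ {n} (w : Fin n → Fin n → ℕ) → (∀ u v → w u v ≡ w v u) → (∀ v → w v v ≡ 0) →
             2 * ∑ (allFin n) (λ u → ∑ (allFin n) (λ v → bit (does (u Fin.<? v)) * w u v))
             ≡ ∑ (allFin n) (λ u → ∑ (allFin n) (w u))
double-∑-< {n} w w-sym w-irrefl = begin
  2 * S                                             ≡⟨ cong (S +_) (+-identityʳ S) ⟩
  S + S                                             ≡⟨ cong (S +_) (∑-swap V V _) ⟩
  S + ∑ V (λ u → ∑ V (λ v → lt v u * w v u))        ≡⟨ ∑-+ V _ _ ⟨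
  ∑ V (λ u → ∑ V (λ v → lt u v * w u v) + ∑ V (λ v → lt v u * w v u))
                                                    ≡⟨ ∑-cong V (λ u → trans (sym (∑-+ V _ _)) (∑-cong V (pointwise u))) ⟩
  ∑ V (λ u → ∑ V (w u))                             ∎
  where
  open ≡-Reasoning
  V = allFin n
  lt : Fin n → Fin n → ℕ
  lt u v = bit (does (u Fin.<? v))
  S = ∑ V (λ u → ∑ V (λ v → lt u v * w u v))
  pointwise : ∀ u v → lt u v * w u v + lt v u * w v u ≡ w u v
  pointwise u v with Fin.<-cmp u v
  ... | tri≈ _ refl _ rewrite w-irrefl v | *-zeroʳ (lt v v) = refl
  ... | tri< u<v _ v≮u rewrite dec-true (u Fin.<? v) u<v | dec-false (v Fin.<? u) v≮u =
    trans (+-identityʳ _) (+-identityʳ _)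
  ... | tri> u≮v _ v<u rewrite dec-false (u Fin.<? v) u≮v | dec-true (v Fin.<? u) v<u =
    trans (+-identityʳ _) (w-sym v u)

∣tabulate∣ : ∀ {n} (f : Fin n → Bool) → ∣ Vec.tabulate f ∣ ≡ ∑ (allFin n) (bit ∘ f)
∣tabulate∣ {zero}  f = refl
∣tabulate∣ {suc n} f = trans (head (f zero)) (cong (bit (f zero) +_) (trans (∣tabulate∣ (f ∘ suc))
  (trans (sym (∑-map suc (allFin n) (bit ∘ f))) (cong (λ xs → ∑ xs (bit ∘ f)) (map-tabulate id suc)))))
  where
  head : ∀ b → ∣ b Vec.∷ Vec.tabulate (f ∘ suc) ∣ ≡ bit b + ∣ Vec.tabulate (f ∘ suc) ∣
  head true  = refl
  head false = refl

module Edges {n : ℕ} (G : Graph n) where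

  V : List (Fin n)
  V = allFin n

  a : Fin n → Fin n → ℕ
  a u v = bit (adj G u v)

  open Weighted a (λ u v → bit-01 (adj G u v)) (λ u v → cong bit (adj-sym G u v))
                  (λ v → cong bit (adj-irrefl G v)) public

  -- After doubling, both sides are the sum over ordered pairs of the adjacencies within `P`: by
  -- `double-∑-<` for the list of edges, by `2e≡E` for `e`.
  edges-in : ∀ {P : Fin n → Set} (P? : Decidable P) →
             length (filter (λ (u , v) → P? u ×-dec P? v) (edges G)) ≡ e (filter P? V)
  edges-in {P} P? = *-cancelˡ-≡ _ _ 2 (begin
    2 * length (filter Q? (edges G))                           ≡⟨ cong (2 *_) count ⟩
    2 * ∑ V (λ u → ∑ V (λ v → bit (does (u Fin.<? v)) * w u v)) ≡⟨ double-∑-< w w-sym w-irrefl ⟩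
    ∑ V (λ u → ∑ V (w u))                                      ≡⟨ ∑-cong V restrict ⟩
    ∑ V (λ u → p u * row u (filter P? V))                      ≡⟨ ∑-filter P? V _ ⟨
    E (filter P? V) (filter P? V)                              ≡⟨ 2e≡E (filter P? V) ⟨
    2 * e (filter P? V)                                        ∎)
    where
    open ≡-Reasoning
    Q? : Decidable (λ ((u , v) : Fin n × Fin n) → P u × P v)
    Q? (u , v) = P? u ×-dec P? v
    R? : Decidable _
    R? (u , v) = (u Fin.<? v) ×-dec T? (adj G u v)
    p : Fin n → ℕ
    p u = bit (does (P? u))
    w : Fin n → Fin n → ℕ
    w u v = p u * (p v * a u v)
    w-sym : ∀ u v → w u v ≡ w v u
    w-sym u v = trans (lemma (p u) (p v) (a u v)) (cong (λ t → p v * (p u * t)) (cong bit (adj-sym G u v)))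
      where
      lemma : ∀ x y z → x * (y * z) ≡ y * (x * z)
      lemma = solve-∀
    w-irrefl : ∀ v → w v v ≡ 0
    w-irrefl v rewrite adj-irrefl G v | *-zeroʳ (p v) = *-zeroʳ (p v)
    restrict : ∀ u → ∑ V (w u) ≡ p u * row u (filter P? V)
    restrict u = trans (∑-*ˡ (p u) V _) (cong (p u *_) (sym (∑-filter P? V (a u))))
    pointwise : ∀ u v → bit (does (R? (u , v))) * bit (does (Q? (u , v))) ≡ bit (does (u Fin.<? v)) * w u v
    pointwise u v = trans (cong₂ _*_ (bit-∧ (does (u Fin.<? v)) (adj G u v)) (bit-∧ (does (P? u)) (does (P? v))))
      (lemma (bit (does (u Fin.<? v))) (a u v) (p u) (p v))
      where
      lemma : ∀ l x y z → l * x * (y * z) ≡ l * (y * (z * x))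
      lemma = solve-∀
    count : length (filter Q? (edges G)) ≡ ∑ V (λ u → ∑ V (λ v → bit (does (u Fin.<? v)) * w u v))
    count = begin
      length (filter Q? (edges G))              ≡⟨ length-filter-∑ Q? (edges G) ⟩
      ∑ (edges G) (λ q → bit (does (Q? q)))     ≡⟨ ∑-filter R? (cartesianProduct V V) _ ⟩
      ∑ (cartesianProduct V V) (λ q → bit (does (R? q)) * bit (does (Q? q)))
                                                ≡⟨ ∑-cartesianProduct V V _ ⟩
      ∑ V (λ u → ∑ V (λ v → bit (does (R? (u , v))) * bit (does (Q? (u , v)))))
                                                ≡⟨ ∑-cong V (λ u → ∑-cong V (pointwise u)) ⟩
      ∑ V (λ u → ∑ V (λ v → bit (does (u Fin.<? v)) * w u v)) ∎

  #edges≡e : #edges G ≡ e V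
  #edges≡e = begin
    length (edges G)
      ≡⟨ cong length (filter-all _ (All.universal (λ _ → tt , tt) (edges G))) ⟨
    length (filter (λ (u , v) → ⊤? u ×-dec ⊤? v) (edges G))  ≡⟨ edges-in ⊤? ⟩
    e (filter ⊤? V)                                          ≡⟨ cong e (filter-all ⊤? (All.universal (λ _ → tt) V)) ⟩
    e V                                                      ∎
    where
    open ≡-Reasoning
    ⊤? : Decidable (λ (_ : Fin n) → _)
    ⊤? _ = yes tt

  #mono≡e : ∀ {c} (φ : Fin n → Fin c) i → #monochromatic G φ i ≡ e (filter (λ v → φ v Fin.≟ i) V)
  #mono≡e φ i = edges-in (λ v → φ v Fin.≟ i)

  LCP⇒Halves : ∀ {k} → LCP 2 k G → Halves k V
  LCP⇒Halves {k} (φ , k≤) =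
    filter is0? V , filter (¬? ∘ is0?) V , filter-↭-++ is0? V ,
    subst (k ≤_) (#mono≡e φ zero) (k≤ zero) ,
    subst (k ≤_) (trans (#mono≡e φ (suc zero)) (cong e (filter-≐ _ _ (only1 , only2) V))) (k≤ (suc zero))
    where
    is0? : Decidable (λ v → φ v ≡ zero)
    is0? v = φ v Fin.≟ zero
    only1 : ∀ {v} → φ v ≡ suc zero → ¬ φ v ≡ zero
    only1 eq eq′ with () ← trans (sym eq) eq′
    only2 : ∀ {v} → ¬ φ v ≡ zero → φ v ≡ suc zero
    only2 {v} ≢0 with φ v
    ... | zero     = contradiction refl ≢0
    ... | suc zero = refl

  -- The vertices are coloured by membership in `A`. Since `allFin n` has no repetitions, `A` and
  -- `B` are disjoint, so all of `B` receives the other colour.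
  Halves⇒LCP : ∀ {k} → Halves k V → LCP 2 k G
  Halves⇒LCP {k} (A , B , p , k≤A , k≤B) = φ , large
    where
    open DecMembership Fin._≟_ using (_∈?_)
    φ : Fin n → Fin 2
    φ v = if does (v ∈? A) then zero else suc zero
    disjoint : Disjoint A B
    disjoint = Unique⇒Disjoint (↭ₛ.Unique-resp-↭ (setoid (Fin n)) (↭⇒↭ₛ p) (allFin⁺ n))
    φA : All (λ v → φ v ≡ zero) A
    φA = All.tabulate λ {v} v∈A → cong (if_then zero else suc zero) (dec-true (v ∈? A) v∈A)
    φB : All (λ v → φ v ≡ suc zero) B
    φB = All.tabulate λ {v} v∈B →
      cong (if_then zero else suc zero) (dec-false (v ∈? A) (λ v∈A → disjoint (v∈A , v∈B)))
    class : ∀ i {X Y} → V ↭ X ++ Y → All (λ v → φ v ≡ i) X → k ≤ e X → k ≤ #monochromatic G φ i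
    class i {X} {Y} q φX k≤ = begin
      k                          ≤⟨ k≤ ⟩
      e X                        ≡⟨ cong e (filter-all φ≟ φX) ⟨
      e (filter φ≟ X)            ≤⟨ eˡ≤e-++ (filter φ≟ X) (filter φ≟ Y) ⟩
      e (filter φ≟ X ++ filter φ≟ Y) ≡⟨ cong e (filter-++ φ≟ X Y) ⟨
      e (filter φ≟ (X ++ Y))     ≡⟨ e-↭ (filter-↭ φ≟ q) ⟨
      e (filter φ≟ V)            ≡⟨ #mono≡e φ i ⟨
      #monochromatic G φ i       ∎
      where
      open ≤-Reasoning
      φ≟ : Decidable (λ v → φ v ≡ i)
      φ≟ v = φ v Fin.≟ i
    large : ∀ i → k ≤ #monochromatic G φ i
    large zero       = class zero p φA k≤A
    large (suc zero) = class (suc zero) (↭-trans p (++-comm A B)) φB k≤B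

  Halves⇒rest : ∀ {k A B v} → V ↭ A ++ B → v List.∈ A → k ≤ e B → row v V + k ≤ e V
  Halves⇒rest {k} {A} {B} {v} p v∈A k≤B with X , q ← ∈⇒↭∷ v∈A = begin
    row v V + k          ≤⟨ +-monoʳ-≤ (row v V) k≤B ⟩
    row v V + e B        ≤⟨ +-monoʳ-≤ (row v V) (eˡ≤e-++ B X) ⟩
    row v V + e (B ++ X) ≡⟨ cong (row v V +_) (e-↭ (++-comm B X)) ⟩
    row v V + e (X ++ B) ≡⟨ delete-vertex (↭-trans p (++⁺ʳ B q)) ⟨
    e V                  ∎
    where open ≤-Reasoning

  LCP⇒rest : ∀ {k} → LCP 2 k G → ∀ v → row v V + k ≤ e V
  LCP⇒rest {k} lcp v with A , B , p , k≤A , k≤B ← LCP⇒Halves lcp with ∈-++⁻ A (∈-resp-↭ p (∈-allFin v))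
  ... | inj₁ v∈A = Halves⇒rest p v∈A k≤B
  ... | inj₂ v∈B = Halves⇒rest (↭-trans p (++-comm A B)) v∈B k≤A

  rest⇒LCP : ∀ {k} → 8 * k ≤ e V → (∀ v → row v V + k ≤ e V) → LCP 2 k G
  rest⇒LCP 8k≤ rest = Halves⇒LCP (halves 8k≤ (λ {v} _ → rest v))

  -- Pendant neighbours and reduced graphs

  a≤row : ∀ u v → a u v ≤ row u V
  a≤row u v = ∑-∈ (a u) (∈-allFin v)

  pendant : Fin n → Fin n → Bool
  pendant v u = adj G v u ∧ (row u V ≡ᵇ 1)

  -- `X` holds all vertices but `v`. A neighbour of `v` without neighbours in `X` has degree 1 and
  -- is therefore pendant.
  a≤pendant+row : ∀ {v X} → V ↭ v ∷ X → ∀ u → a v u ≤ bit (pendant v u) + row u X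
  a≤pendant+row {v} {X} p u with adj G v u in vu
  ... | false = z≤n
  ... | true with row u V ≡ᵇ 1 in eq | row u X in eqX
  ... | true  | _     = s≤s z≤n
  ... | false | suc _ = s≤s z≤n
  ... | false | zero  = contradiction (trans (sym eq) (cong (_≡ᵇ 1) row≡1)) λ ()
    where
    row≡1 : row u V ≡ 1
    row≡1 = trans (row-↭ u p) (cong₂ _+_ (cong bit (trans (adj-sym G u v) vu)) eqX)

  leaves : Fin n → Subset n
  leaves v = Vec.tabulate (pendant v)

  ∈-leaves⁻ : ∀ {v u} → u Subset.∈ leaves v → adj G v u ≡ true × row u V ≡ 1
  ∈-leaves⁻ {v} {u} u∈
    with adj G v u | row u V ≡ᵇ 1 in eq | trans (sym (Vec.lookup∘tabulate (pendant v) u)) (Vec.[]=⇒lookup u∈)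
  ... | true | true | _ = refl , ≡ᵇ⇒≡ (row u V) 1 (subst T (sym eq) tt)

  ∈-N⁺ : ∀ {v u} → adj G v u ≡ true → u Subset.∈ N G v
  ∈-N⁺ {v} {u} vu = Vec.lookup⇒[]= u (N G v) (trans (Vec.lookup∘tabulate (adj G v) u) vu)

  ∈-N⁻ : ∀ {v u} → u Subset.∈ N G v → adj G v u ≡ true
  ∈-N⁻ {v} {u} u∈ = trans (sym (Vec.lookup∘tabulate (adj G v) u)) (Vec.[]=⇒lookup u∈)

  leaf-neighbour : ∀ {v u w} → u Subset.∈ leaves v → w Subset.∈ N G u → w ≡ v
  leaf-neighbour {v} {u} {w} u∈ w∈ with X , p ← ∈⇒↭∷ (∈-allFin v) with ∈-resp-↭ p (∈-allFin w)
  ... | here w≡v  = w≡v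
  ... | there w∈X = contradiction (begin
    2               ≡⟨ cong₂ _+_ (cong bit uv) (cong bit (∈-N⁻ w∈)) ⟨
    a u v + a u w   ≤⟨ +-monoʳ-≤ (a u v) (∑-∈ (a u) w∈X) ⟩
    a u v + row u X ≡⟨ row-↭ u p ⟨
    row u V         ≡⟨ proj₂ (∈-leaves⁻ u∈) ⟩
    1               ∎) 1+n≰n
    where
    open ≤-Reasoning
    uv : adj G u v ≡ true
    uv = trans (adj-sym G u v) (proj₁ (∈-leaves⁻ u∈))

  -- A pendant neighbour of `v` has no neighbour besides `v`, and the whole set `leaves v` serves as
  -- the private set of `v`.
  obstacle : ∀ {k} v → k ≤ ∣ leaves v ∣ → Obstacle 1 k G ⁅ v ⁆ (leaves v)
  obstacle {k} v k≤ = record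
    { disjoint   = λ (u , u∈) → let u∈v , u∈leaves = x∈p∩q⁻ ⁅ v ⁆ (leaves v) u∈ in
        true≢false (trans (sym (proj₁ (∈-leaves⁻ {v} u∈leaves)))
          (trans (cong (adj G v) (x∈⁅y⁆⇒x≡y v u∈v)) (adj-irrefl G v)))
    ; nonempty   = v , p⊆p∪q (leaves v) (x∈⁅x⁆ v)
    ; card       = ∣⁅x⁆∣≡1 v
    ; N⊆V₁       = λ u u∈ w∈ → subst (Subset._∈ ⁅ v ⁆) (sym (leaf-neighbour u∈ w∈)) (x∈⁅x⁆ v)
    ; W          = λ _ → leaves v
    ; W⊆         = λ w w∈ {u} u∈ → x∈p∩q⁺ (subst (λ w → u Subset.∈ N G w) (sym (x∈⁅y⁆⇒x≡y v w∈))
        (∈-N⁺ (proj₁ (∈-leaves⁻ {v} u∈))) , u∈)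
    ; W-large    = λ _ _ → k≤
    ; W-disjoint = λ u w u∈ w∈ u≢w → contradiction (trans (x∈⁅y⁆⇒x≡y v u∈) (sym (x∈⁅y⁆⇒x≡y v w∈))) u≢w
    }
    where
    true≢false : ¬ true ≡ false
    true≢false ()

  -- At least 2k of the neighbours of `v` are not pendant, so each of them is an end of an edge
  -- inside `X`. An edge has two ends, which leaves at least k such edges.
  few-leaves⇒rest : ∀ {k} v → ∣ leaves v ∣ ≤ k → 3 * k ≤ row v V → row v V + k ≤ e V
  few-leaves⇒rest {k} v few 3k≤ with X , p ← ∈⇒↭∷ (∈-allFin v) = begin
    row v V + k   ≤⟨ +-monoʳ-≤ (row v V) (*-cancelˡ-≤ 2 k≤eX) ⟩
    row v V + e X ≡⟨ delete-vertex p ⟨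
    e V           ∎
    where
    open ≤-Reasoning
    leaves≥ : ∑ X (bit ∘ pendant v) ≤ k
    leaves≥ = begin
      ∑ X (bit ∘ pendant v)       ≤⟨ m≤n+m _ (bit (pendant v v)) ⟩
      ∑ (v ∷ X) (bit ∘ pendant v) ≡⟨ ∑-↭ (bit ∘ pendant v) p ⟨
      ∑ V (bit ∘ pendant v)       ≡⟨ ∣tabulate∣ (pendant v) ⟨
      ∣ leaves v ∣                ≤⟨ few ⟩
      k                           ∎
    row≤ : row v V ≤ k + 2 * e X
    row≤ = begin
      row v V                                  ≡⟨ row-↭ v p ⟩
      a v v + row v X                          ≡⟨ cong (λ b → bit b + row v X) (adj-irrefl G v) ⟩
      row v X                                  ≤⟨ ∑-mono X (a≤pendant+row p) ⟩
      ∑ X (λ u → bit (pendant v u) + row u X)  ≡⟨ ∑-+ X (bit ∘ pendant v) (λ u → row u X) ⟩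
      ∑ X (bit ∘ pendant v) + E X X            ≤⟨ +-mono-≤ leaves≥ (≤-reflexive (sym (2e≡E X))) ⟩
      k + 2 * e X                              ∎
    k≤eX : 2 * k ≤ 2 * e X
    k≤eX = +-cancelˡ-≤ k (2 * k) (2 * e X) (≤-trans 3k≤ row≤)

  reduced⇒rest : ∀ {k} → Reduced 2 k G → 8 * k ≤ e V → ∀ v → row v V + k ≤ e V
  reduced⇒rest {k} reduced 8k≤ v with k ≤? ∣ leaves v ∣ | 3 * k ≤? row v V
  ... | yes k≤ | _       = contradiction (obstacle v k≤) (reduced 1 (s≤s (s≤s z≤n)) ⁅ v ⁆ (leaves v))
  ... | no k≰  | yes 3k≤ = few-leaves⇒rest v (<⇒≤ (≰⇒> k≰)) 3k≤
  -- Here the degree is below 3k, while there are at least 8k edges.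
  ... | no _   | no 3k≰  = begin
    row v V + k ≤⟨ +-monoˡ-≤ k (<⇒≤ (≰⇒> 3k≰)) ⟩
    3 * k + k   ≡⟨ +-comm (3 * k) k ⟩
    4 * k       ≤⟨ *-monoˡ-≤ k {4} {8} (s≤s (s≤s (s≤s (s≤s z≤n)))) ⟩
    8 * k       ≤⟨ 8k≤ ⟩
    e V         ∎
    where open ≤-Reasoning

  -- Isolated vertices and the subgraph without them

  Isolated : Fin n → Set
  Isolated u = row u V ≡ 0

  isolated-row : ∀ {u} X → Isolated u → row u X ≡ 0
  isolated-row {u} X iso = ∑-0 X (λ v → n≤0⇒n≡0 (≤-trans (a≤row u v) (≤-reflexive iso)))

  e-isolated : ∀ {D} X → All Isolated D → e (D ++ X) ≡ e X
  e-isolated X []                      = refl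
  e-isolated X (_∷_ {xs = D} iso isos) = cong₂ _+_ (isolated-row (D ++ X) iso) (e-isolated X isos)

  nonisolated? : Decidable (λ u → 0 < row u V)
  nonisolated? u = 0 <? row u V

  kept isolated : List (Fin n)
  kept     = filter nonisolated? V
  isolated = filter (¬? ∘ nonisolated?) V

  V↭ : V ↭ isolated ++ kept
  V↭ = ↭-trans (filter-↭-++ nonisolated? V) (++-comm kept isolated)

  all-isolated : All Isolated isolated
  all-isolated = All.map (λ ≮ → n≤0⇒n≡0 (≮⇒≥ ≮)) (All.all-filter (¬? ∘ nonisolated?) V)

  e-kept : ∀ {P : Fin n → Set} (P? : Decidable P) → e (filter P? V) ≡ e (filter P? kept)
  e-kept P? = begin
    e (filter P? V)                          ≡⟨ e-↭ (filter-↭ P? V↭) ⟩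
    e (filter P? (isolated ++ kept))         ≡⟨ cong e (filter-++ P? isolated kept) ⟩
    e (filter P? isolated ++ filter P? kept) ≡⟨ e-isolated (filter P? kept) (All.filter⁺ P? all-isolated) ⟩
    e (filter P? kept)                       ∎
    where open ≡-Reasoning

  -- Every vertex in `kept` contributes at least 1 to the degree sum.
  length-kept : length kept ≤ 2 * e V
  length-kept = begin
    length kept                             ≡⟨ length-filter-∑ nonisolated? V ⟩
    ∑ V (λ u → bit (does (nonisolated? u))) ≤⟨ ∑-mono V positive ⟩
    E V V                                   ≡⟨ 2e≡E V ⟨
    2 * e V                                 ∎
    where
    open ≤-Reasoning
    positive : ∀ u → bit (does (nonisolated? u)) ≤ row u V
    positive u with row u V
    ... | zero  = z≤n
    ... | suc _ = s≤s z≤n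

  induced : Graph (length kept)
  induced = record
    { adj        = λ i j → adj G (lookup kept i) (lookup kept j)
    ; adj-sym    = λ i j → adj-sym G (lookup kept i) (lookup kept j)
    ; adj-irrefl = λ i → adj-irrefl G (lookup kept i)
    }

-- Load colourings with and without the isolated vertices

module _ {n : ℕ} (G : Graph n) where

  private
    module G  = Edges G
    module G′ = Edges (Edges.induced G)

  ι : Fin (length (Edges.kept G)) → Fin n
  ι = lookup G.kept

  map-ι : map ι G′.V ≡ G.kept
  map-ι = trans (map-tabulate id ι) (tabulate-lookup G.kept)

  row-ι : ∀ i X → G′.row i X ≡ G.row (ι i) (map ι X)
  row-ι i X = sym (∑-map ι X (G.a (ι i)))

  e-ι : ∀ X → G′.e X ≡ G.e (map ι X)
  e-ι []      = refl
  e-ι (i ∷ X) = cong₂ _+_ (row-ι i X) (e-ι X)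

  e-induced : G′.e G′.V ≡ G.e G.V
  e-induced = begin
    G′.e G′.V                  ≡⟨ e-ι G′.V ⟩
    G.e (map ι G′.V)           ≡⟨ cong G.e map-ι ⟩
    G.e G.kept                 ≡⟨ G.e-isolated G.kept G.all-isolated ⟨
    G.e (G.isolated ++ G.kept) ≡⟨ G.e-↭ G.V↭ ⟨
    G.e G.V                    ∎
    where open ≡-Reasoning

  LCP⇒LCP-induced : ∀ {c k} → LCP c k G → LCP c k G.induced
  LCP⇒LCP-induced {c} {k} (φ , k≤) = φ ∘ ι , λ i → subst (k ≤_) (same i) (k≤ i)
    where
    open ≡-Reasoning
    same : ∀ i → #monochromatic G φ i ≡ #monochromatic G.induced (φ ∘ ι) i
    same i = begin
      #monochromatic G φ i                        ≡⟨ G.#mono≡e φ i ⟩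
      G.e (filter φ≟ G.V)                         ≡⟨ G.e-kept φ≟ ⟩
      G.e (filter φ≟ G.kept)                      ≡⟨ cong (G.e ∘ filter φ≟) map-ι ⟨
      G.e (filter φ≟ (map ι G′.V))                ≡⟨ cong G.e (map-filter φ≟ ι G′.V) ⟨
      G.e (map ι (filter (φ≟ ∘ ι) G′.V))          ≡⟨ e-ι (filter (φ≟ ∘ ι) G′.V) ⟨
      G′.e (filter (φ≟ ∘ ι) G′.V)                 ≡⟨ G′.#mono≡e (φ ∘ ι) i ⟨
      #monochromatic G.induced (φ ∘ ι) i          ∎
      where
      φ≟ : Decidable (λ v → φ v ≡ i)
      φ≟ v = φ v Fin.≟ i

  -- Passing through `Halves` avoids inverting `ι` to extend a colouring: the isolated vertices are
  -- appended to the second half, which cannot lose edges.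
  LCP-induced⇒LCP : ∀ {k} → LCP 2 k G.induced → LCP 2 k G
  LCP-induced⇒LCP {k} lcp with A , B , p , k≤A , k≤B ← G′.LCP⇒Halves lcp =
    G.Halves⇒LCP (map ι A , map ι B ++ G.isolated , perm ,
      subst (k ≤_) (e-ι A) k≤A ,
      ≤-trans (subst (k ≤_) (e-ι B) k≤B) (G.eˡ≤e-++ (map ι B) G.isolated))
    where
    perm : G.V ↭ map ι A ++ map ι B ++ G.isolated
    perm = ↭-trans G.V↭ (↭-trans (++-comm G.isolated G.kept)
      (↭-trans (++⁺ʳ G.isolated (↭-trans (↭-reflexive (sym map-ι))
        (↭-trans (map⁺ ι p) (↭-reflexive (map-++ ι A B)))))
        (++-assoc (map ι A) (map ι B) G.isolated)))

reduced⇒LCP : ∀ (k n : ℕ) (G : Graph n) → Reduced 2 k G → 8 * k ≤ #edges G → LCP 2 k G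
reduced⇒LCP k n G reduced 8k≤#edges = rest⇒LCP 8k≤ (reduced⇒rest reduced 8k≤)
  where
  open Edges G using (rest⇒LCP; reduced⇒rest; #edges≡e)
  8k≤ = subst (8 * k ≤_) #edges≡e 8k≤#edges

-- Running times and postconditions of programs

Runs : Cmd → Store → (Store → Set) → ℕ → Set
Runs P σ Q T = ∃[ σ′ ] ∃[ t ] (P ∣ σ ⇓ σ′ ∣ t) × Q σ′ × t ≤ T

module _ {Q : Store → Set} where

  skip-end : ∀ {σ T} → Q σ → Runs skip σ Q T
  skip-end q = _ , _ , ⇓skip , q , z≤n

  reg-end : ∀ {σ x e T} → Q (setReg σ x (⟦ e ⟧ σ)) → Runs (x ≔ e) σ Q (suc T)
  reg-end q = _ , _ , ⇓reg , q , s≤s z≤n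

  arr-end : ∀ {σ b d e T} → Q (setArr σ b (⟦ d ⟧ σ) (⟦ e ⟧ σ)) → Runs (b ⟦ d ⟧≔ e) σ Q (suc T)
  arr-end q = _ , _ , ⇓arr , q , s≤s z≤n

  reg-then : ∀ {σ x e p T} → Runs p (setReg σ x (⟦ e ⟧ σ)) Q T → Runs ((x ≔ e) ⨾ p) σ Q (suc T)
  reg-then (σ′ , t , run , q , t≤) = σ′ , _ , ⇓seq ⇓reg run , q , s≤s t≤

  arr-then : ∀ {σ b d e p T} → Runs p (setArr σ b (⟦ d ⟧ σ) (⟦ e ⟧ σ)) Q T → Runs ((b ⟦ d ⟧≔ e) ⨾ p) σ Q (suc T)
  arr-then (σ′ , t , run , q , t≤) = σ′ , _ , ⇓seq ⇓arr run , q , s≤s t≤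

  seq : ∀ {P : Store → Set} {σ p q S T} →
        Runs p σ P S → (∀ {σ′} → P σ′ → Runs q σ′ Q T) → Runs (p ⨾ q) σ Q (S + T)
  seq (σ′ , s , run , p , s≤) next with σ″ , t , run′ , q , t≤ ← next p =
    σ″ , _ , ⇓seq run run′ , q , +-mono-≤ s≤ t≤

  cond : ∀ {σ e p q T} → (⟦ e ⟧ σ ≢ 0 → Runs p σ Q T) → (⟦ e ⟧ σ ≡ 0 → Runs q σ Q T) →
         Runs (If e Then p Else q) σ Q (suc T)
  cond {σ} {e} onThen onElse with ⟦ e ⟧ σ ≟ 0
  ... | yes ≡0 with σ′ , t , run , q , t≤ ← onElse ≡0 = σ′ , _ , ⇓else ≡0 run , q , s≤s t≤
  ... | no ≢0  with σ′ , t , run , q , t≤ ← onThen ≢0 = σ′ , _ , ⇓then ≢0 run , q , s≤s t≤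

  weaken : ∀ {P σ S T} → S ≤ T → Runs P σ Q S → Runs P σ Q T
  weaken S≤T (σ′ , t , run , q , t≤) = σ′ , t , run , q , ≤-trans t≤ S≤T

consequence : ∀ {P σ T} {Q R : Store → Set} → (∀ {σ′} → Q σ′ → R σ′) → Runs P σ Q T → Runs P σ R T
consequence Q⇒R (σ′ , t , run , q , t≤) = σ′ , t , run , Q⇒R q , t≤

-- The rule for loops with a counter: the guard evaluates to the number of passes still to come, so
-- it vanishes exactly after m of them. Each pass costs its test and at most T steps, and the final
-- test costs one more.
count : ∀ {e p m T} (Inv : ℕ → Store → Set) →
        (∀ {i σ} → Inv i σ → ⟦ e ⟧ σ ≡ m ∸ i) →
        (∀ (i : Fin m) {σ} → Inv (toℕ i) σ → Runs p σ (Inv (suc (toℕ i))) T) →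
        ∀ {σ} → Inv 0 σ → Runs (While e Do p) σ (Inv m) (suc (m * suc T))
count {e} {p} {m} {T} Inv guard step = go 0 m refl
  where
  go : ∀ i r → i + r ≡ m → ∀ {σ} → Inv i σ → Runs (While e Do p) σ (Inv m) (suc (r * suc T))
  go i zero i+0≡m inv rewrite trans (sym (+-identityʳ i)) i+0≡m =
    _ , _ , ⇓exit (trans (guard inv) (n∸n≡0 m)) , inv , s≤s z≤n
  go i (suc r) i+r≡m {σ} inv with i<m ← subst (i <_) i+r≡m (m<m+n i (s≤s z≤n))
    with σ′ , s , run , inv′ , s≤ ← step (fromℕ< i<m) (subst (λ j → Inv j σ) (sym (Fin.toℕ-fromℕ< i<m)) inv)
    with σ″ , t , run′ , inv″ , t≤ ← go (suc i) r (trans (sym (+-suc i r)) i+r≡m)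
                                         (subst (λ j → Inv (suc j) σ′) (Fin.toℕ-fromℕ< i<m) inv′) =
    σ″ , _ , ⇓loop (λ ≡0 → <⇒≢ (m<n⇒0<n∸m i<m) (sym (trans (sym (guard inv)) ≡0))) run run′ , inv″ ,
    ≤-trans (s≤s (+-mono-≤ s≤ t≤)) (≤-reflexive (cong suc (+-suc T (r * suc T))))

-- With truncated subtraction a machine computes maxima in this way; `scanVertex` does so in
-- register 9.
m+[n∸m]≡m⊔n : ∀ m n → m + (n ∸ m) ≡ m ⊔ n
m+[n∸m]≡m⊔n m n with ≤-total m n
... | inj₁ m≤n = trans (m+[n∸m]≡n m≤n) (sym (m≤n⇒m⊔n≡n m≤n))
... | inj₂ n≤m = trans (cong (m +_) (m≤n⇒m∸n≡0 n≤m)) (trans (+-identityʳ m) (sym (m≥n⇒m⊔n≡m n≤m)))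

update-same : ∀ {A : Set} (f : ℕ → A) i x {j} → j ≡ i → update f i x j ≡ x
update-same f i x {j} j≡i rewrite dec-true (j ≟ i) j≡i = refl

update-other : ∀ {A : Set} (f : ℕ → A) i x {j} → j ≢ i → update f i x j ≡ f j
update-other f i x {j} j≢i rewrite dec-false (j ≟ i) j≢i = refl

module _ {A : Set} (f : A → ℕ) where

  -- The offset `o` lets the condition pass to the tail of the list while the array stays fixed.
  Stores : ℕ → List A → (ℕ → ℕ) → Set
  Stores o []       arr = ⊤
  Stores o (x ∷ xs) arr = arr o ≡ f x × Stores (suc o) xs arr

  Stores-∷ʳ : ∀ {o xs arr i x y} → Stores o xs arr → i ≡ o + length xs → y ≡ f x →
              Stores o (xs ∷ʳ x) (update arr i y)
  Stores-∷ʳ {o} {[]}     {arr} {i} {_} {y} _         i≡ y≡ =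
    trans (update-same arr i y (sym (trans i≡ (+-identityʳ o)))) y≡ , tt
  Stores-∷ʳ {o} {z ∷ xs} {arr} {i} {_} {y} (z≡ , st) i≡ y≡ =
    trans (update-other arr i y (λ o≡i → m≢1+m+n o (trans o≡i (trans i≡ (+-suc o (length xs)))))) z≡ ,
    Stores-∷ʳ st (trans i≡ (+-suc o (length xs))) y≡

  Stores-lookup : ∀ {o xs arr} → Stores o xs arr → ∀ i → arr (o + toℕ i) ≡ f (lookup xs i)
  Stores-lookup {o} {x ∷ xs} {arr} (x≡ , st) zero    = trans (cong arr (+-identityʳ o)) x≡
  Stores-lookup {o} {x ∷ xs} {arr} (x≡ , st) (suc i) =
    trans (cong arr (+-suc o (toℕ i))) (Stores-lookup st i)

-- The input matrix and the program

input-matrix : ∀ I p → arrs (input I) 0 (toℕ p) ≡ matrix (graph I) p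
input-matrix I p with toℕ p <? order I * order I
... | yes p<n² = cong (matrix (graph I)) (Fin.fromℕ<-toℕ p p<n²)
... | no  p≮n² = contradiction (Fin.toℕ<n p) p≮n²

input-adj : ∀ I u v → arrs (input I) 0 (order I * toℕ u + toℕ v) ≡ bit (adj (graph I) u v)
input-adj I u v = begin
  arrs (input I) 0 (order I * toℕ u + toℕ v)  ≡⟨ cong (arrs (input I) 0) (Fin.toℕ-combine u v) ⟨
  arrs (input I) 0 (toℕ (combine u v))        ≡⟨ input-matrix I (combine u v) ⟩
  matrix (graph I) (combine u v)              ≡⟨ cong (λ p → bit (uncurry (adj (graph I)) p)) (Fin.remQuot-combine u v) ⟩
  bit (adj (graph I) u v)                     ∎
  where open ≡-Reasoning

-- Written out, b ⟦ e ⟧ also parses as b applied to the semantics of e.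
load : ℕ → Exp → Exp
load = _⟦_⟧

-- Registers 4 and 5 hold the current row and column, register 7 the sum of the row so far. Register
-- 6 holds the order times the row number, maintained by addition.
sumRow : Cmd
sumRow = While reg 0 ⊖ reg 5 Do
  (7 ≔ reg 7 ⊕ load 0 (reg 6 ⊕ reg 5) ⨾
   5 ≔ reg 5 ⊕ lit 1)

-- Register 8 accumulates the sum of the degrees, register 9 their maximum and
-- register 10 the number of non-isolated vertices; arrays 2 and 3 list these
-- vertices and the offsets of their rows in the adjacency matrix.
scanVertex : Cmd
scanVertex =
  7 ≔ lit 0 ⨾
  5 ≔ lit 0 ⨾
  sumRow ⨾
  8 ≔ reg 8 ⊕ reg 7 ⨾
  9 ≔ reg 9 ⊕ (reg 7 ⊖ reg 9) ⨾
  (If reg 7 Then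
     (2 ⟦ reg 10 ⟧≔ reg 4 ⨾
      3 ⟦ reg 10 ⟧≔ reg 6 ⨾
      10 ≔ reg 10 ⊕ lit 1)
   Else skip) ⨾
  6 ≔ reg 6 ⊕ reg 0 ⨾
  4 ≔ reg 4 ⊕ lit 1

scan : Cmd
scan = While reg 0 ⊖ reg 4 Do scanVertex

-- Array 3 supplies the row offset in the old matrix ready-made, so no product is formed. Register 6
-- is now the row offset in the new matrix.
copyRow : Cmd
copyRow = While reg 10 ⊖ reg 5 Do
  (1 ⟦ reg 6 ⊕ reg 5 ⟧≔ load 0 (load 3 (reg 4) ⊕ load 2 (reg 5)) ⨾
   5 ≔ reg 5 ⊕ lit 1)

copyVertex : Cmd
copyVertex =
  5 ≔ lit 0 ⨾
  copyRow ⨾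
  6 ≔ reg 6 ⊕ reg 10 ⨾
  4 ≔ reg 4 ⊕ lit 1

copy : Cmd
copy =
  2 ≔ reg 10 ⨾
  3 ≔ reg 1 ⨾
  4 ≔ lit 0 ⨾
  6 ≔ lit 0 ⨾
  While reg 10 ⊖ reg 4 Do copyVertex

answerNo : Cmd
answerNo = 2 ≔ lit 0 ⨾ 3 ≔ lit 1

-- The last four assignments set the entries (0 , 1), (1 , 0), (2 , 3) and
-- (3 , 2) of a 4 × 4 matrix.
answerYes : Cmd
answerYes =
  2 ≔ lit 4 ⨾
  3 ≔ lit 1 ⨾
  1 ⟦ lit 1 ⟧≔ lit 1 ⨾
  1 ⟦ lit 4 ⟧≔ lit 1 ⨾
  1 ⟦ lit 11 ⟧≔ lit 1 ⨾
  1 ⟦ lit 14 ⟧≔ lit 1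

double : Exp → Exp
double e = e ⊕ e

-- Register 8 holds the degree sum 2m, so both tests are doubled: the first asks whether 16k > 2m,
-- the second whether 2(k + maximum degree) > 2m.
answer : Cmd
answer =
  If double (double (double (double (reg 1)))) ⊖ reg 8 Then copy Else
  (If double (reg 1 ⊕ reg 9) ⊖ reg 8 Then answerNo Else answerYes)

program : Cmd
program = scan ⨾ answer

-- Correctness of the scan

module Scan (I : Instance) where

  private
    n = order I
    k = param I
    G = graph I

  open Edges G using (V; a; row; nonisolated?)

  maxRow : List (Fin n) → ℕ
  maxRow []       = 0
  maxRow (x ∷ xs) = row x V ⊔ maxRow xs

  maxRow-∷ʳ : ∀ xs x → maxRow xs ⊔ row x V ≡ maxRow (xs ∷ʳ x)
  maxRow-∷ʳ []       x = sym (⊔-identityʳ (row x V))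
  maxRow-∷ʳ (y ∷ xs) x = trans (⊔-assoc (row y V) (maxRow xs) (row x V)) (cong (row y V ⊔_) (maxRow-∷ʳ xs x))

  maxRow-upper : ∀ {xs x} → x List.∈ xs → row x V ≤ maxRow xs
  maxRow-upper {x ∷ xs} (here refl)  = m≤m⊔n (row x V) (maxRow xs)
  maxRow-upper {y ∷ xs} (there x∈xs) = ≤-trans (maxRow-upper x∈xs) (m≤n⊔m (row y V) (maxRow xs))

  maxRow-least : ∀ {b} xs → (∀ x → row x V ≤ b) → maxRow xs ≤ b
  maxRow-least []       ≤b = z≤n
  maxRow-least (x ∷ xs) ≤b = ⊔-lub (≤b x) (maxRow-least xs ≤b)

  nonisolated : List (Fin n) → List (Fin n)
  nonisolated = filter nonisolated?

  -- Indexed by the registers and arrays concerned, so that assignments to any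
  -- others leave the type unchanged.
  record Scanned (xs : List (Fin n)) (m r₀ r₁ r₄ r₆ r₈ r₉ r₁₀ : ℕ) (a₀ a₁ a₂ a₃ : ℕ → ℕ) : Set where
    field
      order≡  : r₀ ≡ n
      param≡  : r₁ ≡ k
      vertex≡ : r₄ ≡ m
      offset≡ : r₆ ≡ n * m
      degrees : r₈ ≡ ∑ xs (λ x → row x V)
      max≡    : r₉ ≡ maxRow xs
      size≡   : r₁₀ ≡ length (nonisolated xs)
      input≡  : ∀ p → a₀ p ≡ arrs (input I) 0 p
      -- `answerYes` writes only the nonzero entries of its matrix and relies on zeros elsewhere.
      clear   : ∀ p → a₁ p ≡ 0
      listed  : Stores toℕ 0 (nonisolated xs) a₂
      offsets : Stores (λ x → n * toℕ x) 0 (nonisolated xs) a₃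

  open Scanned

  -- The list and the counter are separate parameters because, towards the end of a pass, `u` is
  -- already recorded while register 4 still points to it.
  ScannedAt : List (Fin n) → ℕ → Store → Set
  ScannedAt xs m σ = Scanned xs m (regs σ 0) (regs σ 1) (regs σ 4) (regs σ 6) (regs σ 8) (regs σ 9) (regs σ 10)
                             (arrs σ 0) (arrs σ 1) (arrs σ 2) (arrs σ 3)

  ∑-take-suc : ∀ f (i : Fin n) → ∑ (take (toℕ i) V) f + f i ≡ ∑ (take (suc (toℕ i)) V) f
  ∑-take-suc f i = begin
    ∑ (take (toℕ i) V) f + f i       ≡⟨ cong (∑ (take (toℕ i) V) f +_) (+-identityʳ (f i)) ⟨
    ∑ (take (toℕ i) V) f + (f i + 0) ≡⟨ ∑-++ (take (toℕ i) V) (i ∷ []) f ⟨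
    ∑ (take (toℕ i) V ∷ʳ i) f        ≡⟨ cong (λ xs → ∑ xs f) (take-suc-tabulate (λ j → j) i) ⟨
    ∑ (take (suc (toℕ i)) V) f       ∎
    where open ≡-Reasoning

  take-V : take n V ≡ V
  take-V = take-all n V (≤-reflexive (length-tabulate (λ j → j)))

  RowSummed : List (Fin n) → Fin n → ℕ → Store → Set
  RowSummed xs u j σ = ScannedAt xs (toℕ u) σ × regs σ 5 ≡ j × regs σ 7 ≡ ∑ (take j V) (a u)

  sumRow-runs : ∀ {xs u σ} → RowSummed xs u 0 σ →
                Runs sumRow σ (λ σ′ → ScannedAt xs (toℕ u) σ′ × regs σ′ 7 ≡ row u V) (suc (n * 3))
  sumRow-runs {xs} {u} start =
    consequence (λ (s , _ , sum≡) → s , trans sum≡ (cong (λ xs → ∑ xs (a u)) take-V))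
      (count {e = reg 0 ⊖ reg 5} (RowSummed xs u) (λ (s , j≡ , _) → cong₂ _∸_ (order≡ s) j≡) step start)
    where
    step : ∀ v {σ} → RowSummed xs u (toℕ v) σ →
           Runs (7 ≔ reg 7 ⊕ load 0 (reg 6 ⊕ reg 5) ⨾ 5 ≔ reg 5 ⊕ lit 1) σ (RowSummed xs u (suc (toℕ v))) 2
    step v {σ} (s , j≡ , sum≡) = reg-then (reg-end
      (s , trans (cong (_+ 1) j≡) (+-comm (toℕ v) 1) , trans (cong₂ _+_ sum≡ entry≡) (∑-take-suc (a u) v)))
      where
      entry≡ : arrs σ 0 (regs σ 6 + regs σ 5) ≡ a u v
      entry≡ = begin
        arrs σ 0 (regs σ 6 + regs σ 5)         ≡⟨ cong (arrs σ 0) (cong₂ _+_ (offset≡ s) j≡) ⟩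
        arrs σ 0 (n * toℕ u + toℕ v)           ≡⟨ input≡ s _ ⟩
        arrs (input I) 0 (n * toℕ u + toℕ v)   ≡⟨ input-adj I u v ⟩
        a u v                                  ∎
        where open ≡-Reasoning

  nonisolated-∷ʳ : ∀ xs {x} → row x V ≢ 0 → nonisolated (xs ∷ʳ x) ≡ nonisolated xs ∷ʳ x
  nonisolated-∷ʳ xs {x} ≢0 = trans (filter-++ nonisolated? xs (x ∷ []))
    (cong (nonisolated xs ++_) (filter-accept nonisolated? (n≢0⇒n>0 ≢0)))

  isolated-∷ʳ : ∀ xs {x} → row x V ≡ 0 → nonisolated (xs ∷ʳ x) ≡ nonisolated xs
  isolated-∷ʳ xs {x} ≡0 = trans (filter-++ nonisolated? xs (x ∷ []))
    (trans (cong (nonisolated xs ++_) (filter-reject nonisolated? (λ 0< → <⇒≢ 0< (sym ≡0)))) (++-identityʳ _))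

  scan-step : ∀ {xs} u {σ} → ScannedAt xs (toℕ u) σ →
              Runs scanVertex σ (ScannedAt (xs ∷ʳ u) (suc (toℕ u))) (11 + n * 3)
  scan-step {xs} u {σ} s₀ =
    weaken (≤-reflexive (lemma (n * 3)))
    (reg-then (reg-then (seq (sumRow-runs (s₀ , refl , refl)) λ (s , d≡) →
    -- The 4 steps are the test and the three assignments of the longer branch.
    reg-then (reg-then (seq {P = ScannedAt (xs ∷ʳ u) (toℕ u)} {S = 4}
      (cond
        (λ d≢0 → let keep = nonisolated-∷ʳ xs (λ ≡0 → d≢0 (trans d≡ ≡0)) in
          arr-then (arr-then (reg-end (record
            { order≡  = order≡ s
            ; param≡  = param≡ s
            ; vertex≡ = vertex≡ s
            ; offset≡ = offset≡ s
            ; degrees = degrees′ s d≡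
            ; max≡    = max′ s d≡
            ; size≡   = trans (cong (_+ 1) (size≡ s)) (trans (sym (length-++ (nonisolated xs))) (cong length (sym keep)))
            ; input≡  = input≡ s
            ; clear   = clear s
            ; listed  = subst (λ ys → Stores toℕ 0 ys _) (sym keep)
                          (Stores-∷ʳ toℕ (listed s) (size≡ s) (vertex≡ s))
            ; offsets = subst (λ ys → Stores (λ x → n * toℕ x) 0 ys _) (sym keep)
                          (Stores-∷ʳ (λ x → n * toℕ x) (offsets s) (size≡ s) (offset≡ s))
            }))))
        (λ d≡0 → let drop = isolated-∷ʳ xs (trans (sym d≡) d≡0) in
          skip-end (record
            { order≡  = order≡ s
            ; param≡  = param≡ s
            ; vertex≡ = vertex≡ s
            ; offset≡ = offset≡ s
            ; degrees = degrees′ s d≡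
            ; max≡    = max′ s d≡
            ; size≡   = trans (size≡ s) (cong length (sym drop))
            ; input≡  = input≡ s
            ; clear   = clear s
            ; listed  = subst (λ ys → Stores toℕ 0 ys _) (sym drop) (listed s)
            ; offsets = subst (λ ys → Stores (λ x → n * toℕ x) 0 ys _) (sym drop) (offsets s)
            })))
      λ s′ → reg-then (reg-end (record
        { order≡  = order≡ s′
        ; param≡  = param≡ s′
        ; vertex≡ = trans (cong (_+ 1) (vertex≡ s′)) (+-comm (toℕ u) 1)
        ; offset≡ = trans (cong₂ _+_ (offset≡ s′) (order≡ s′)) (trans (+-comm (n * toℕ u) n) (sym (*-suc n (toℕ u))))
        ; degrees = degrees s′
        ; max≡    = max≡ s′
        ; size≡   = size≡ s′
        ; input≡  = input≡ s′
        ; clear   = clear s′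
        ; listed  = listed s′
        ; offsets = offsets s′
        })))))))
    where
    lemma : ∀ t → 2 + (suc t + (2 + (4 + 2))) ≡ 11 + t
    lemma = solve-∀
    degrees′ : ∀ {r₀ r₁ r₄ r₆ r₇ r₈ r₉ r₁₀ a₀ a₁ a₂ a₃} →
               Scanned xs (toℕ u) r₀ r₁ r₄ r₆ r₈ r₉ r₁₀ a₀ a₁ a₂ a₃ → r₇ ≡ row u V →
               r₈ + r₇ ≡ ∑ (xs ∷ʳ u) (λ x → row x V)
    degrees′ s d≡ = trans (cong₂ _+_ (degrees s) (trans d≡ (sym (+-identityʳ _)))) (sym (∑-++ xs (u ∷ []) _))
    max′ : ∀ {r₀ r₁ r₄ r₆ r₇ r₈ r₉ r₁₀ a₀ a₁ a₂ a₃} →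
           Scanned xs (toℕ u) r₀ r₁ r₄ r₆ r₈ r₉ r₁₀ a₀ a₁ a₂ a₃ → r₇ ≡ row u V →
           r₉ + (r₇ ∸ r₉) ≡ maxRow (xs ∷ʳ u)
    max′ {r₇ = r₇} {r₉ = r₉} s d≡ =
      trans (m+[n∸m]≡m⊔n r₉ r₇) (trans (cong₂ _⊔_ (max≡ s) d≡) (maxRow-∷ʳ xs u))

  scan-start : ScannedAt [] 0 (input I)
  scan-start = record
    { order≡  = refl
    ; param≡  = refl
    ; vertex≡ = refl
    ; offset≡ = sym (*-zeroʳ n)
    ; degrees = refl
    ; max≡    = refl
    ; size≡   = refl
    ; input≡  = λ _ → refl
    ; clear   = λ _ → refl
    ; listed  = tt
    ; offsets = tt
    }

  scan-runs : Runs scan (input I) (ScannedAt V n) (suc (n * suc (11 + n * 3)))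
  scan-runs = consequence (λ {σ} → subst (λ xs → ScannedAt xs n σ) take-V)
    (count {e = reg 0 ⊖ reg 4} {p = scanVertex} (λ m → ScannedAt (take m V) m)
      (λ s → cong₂ _∸_ (order≡ s) (vertex≡ s))
      (λ u {σ} s → subst (λ xs → Runs scanVertex σ (ScannedAt xs (suc (toℕ u))) (11 + n * 3))
        (sym (take-suc-tabulate (λ j → j) u)) (scan-step u s))
      scan-start)

-- Copying the graph without its isolated vertices

compress : Instance → Instance
compress I = record
  { order   = length (Edges.kept (graph I))
  ; graph   = Edges.induced (graph I)
  ; param   = param I
  ; 1≤param = 1≤param I
  }

module Copy (I : Instance) where

  open Scan I
  open Scanned
  open Edges (graph I) using (kept; induced)

  private
    n = order I
    c = order (compress I)
    -- Taking the input array of `compress I` as the goal makes `input-adj` available for both the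
    -- entry read and the entry written.
    target = arrs (input (compress I)) 0

  -- The first `w` cells of array 1 are final. Within a row `w` advances while the row number `m`
  -- stands still.
  record Copied (m w r₂ r₃ r₄ r₆ r₁₀ : ℕ) (a₀ a₁ a₂ a₃ : ℕ → ℕ) : Set where
    field
      order≡  : r₂ ≡ c
      param≡  : r₃ ≡ param I
      vertex≡ : r₄ ≡ m
      offset≡ : r₆ ≡ c * m
      size≡   : r₁₀ ≡ c
      input≡  : ∀ p → a₀ p ≡ arrs (input I) 0 p
      written : ∀ p → p < w → a₁ p ≡ target p
      listed  : ∀ i → a₂ (toℕ i) ≡ toℕ (lookup kept i)
      offsets : ∀ i → a₃ (toℕ i) ≡ n * toℕ (lookup kept i)

  open Copied

  CopiedAt : ℕ → ℕ → Store → Set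
  CopiedAt m w σ = Copied m w (regs σ 2) (regs σ 3) (regs σ 4) (regs σ 6) (regs σ 10)
                          (arrs σ 0) (arrs σ 1) (arrs σ 2) (arrs σ 3)

  RowCopied : Fin c → ℕ → Store → Set
  RowCopied u j σ = CopiedAt (toℕ u) (c * toℕ u + j) σ × regs σ 5 ≡ j

  copy-entry : ∀ u v {σ} → RowCopied u (toℕ v) σ →
               Runs (1 ⟦ reg 6 ⊕ reg 5 ⟧≔ load 0 (load 3 (reg 4) ⊕ load 2 (reg 5)) ⨾ 5 ≔ reg 5 ⊕ lit 1) σ
                    (RowCopied u (suc (toℕ v))) 2
  copy-entry u v {σ} (s , j≡) = arr-then (reg-end (record
    { order≡  = order≡ s
    ; param≡  = param≡ s
    ; vertex≡ = vertex≡ s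
    ; offset≡ = offset≡ s
    ; size≡   = size≡ s
    ; input≡  = input≡ s
    ; written = written′
    ; listed  = listed s
    ; offsets = offsets s
    } , trans (cong (_+ 1) j≡) (+-comm (toℕ v) 1)))
    where
    position : ℕ
    position = regs σ 6 + regs σ 5
    position≡ : position ≡ c * toℕ u + toℕ v
    position≡ = cong₂ _+_ (offset≡ s) j≡
    value : ℕ
    value = arrs σ 0 (arrs σ 3 (regs σ 4) + arrs σ 2 (regs σ 5))
    value≡ : value ≡ target (c * toℕ u + toℕ v)
    value≡ = begin
      value
        ≡⟨ cong₂ (λ x y → arrs σ 0 (arrs σ 3 x + arrs σ 2 y)) (vertex≡ s) j≡ ⟩
      arrs σ 0 (arrs σ 3 (toℕ u) + arrs σ 2 (toℕ v))
                                                ≡⟨ cong₂ (λ x y → arrs σ 0 (x + y)) (offsets s u) (listed s v) ⟩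
      arrs σ 0 (n * toℕ (lookup kept u) + toℕ (lookup kept v))
                                                ≡⟨ input≡ s _ ⟩
      arrs (input I) 0 (n * toℕ (lookup kept u) + toℕ (lookup kept v))
                                                ≡⟨ input-adj I (lookup kept u) (lookup kept v) ⟩
      bit (adj induced u v)                     ≡⟨ input-adj (compress I) u v ⟨
      target (c * toℕ u + toℕ v)                ∎
      where open ≡-Reasoning
    written′ : ∀ p → p < c * toℕ u + suc (toℕ v) → update (arrs σ 1) position value p ≡ target p
    written′ p p< with p ≟ position
    ... | yes p≡ = trans (update-same (arrs σ 1) position value p≡)
      (trans value≡ (cong target (sym (trans p≡ position≡))))
    ... | no p≢  = trans (update-other (arrs σ 1) position value p≢) (written s p
      (≤∧≢⇒< (≤-pred (subst (p <_) (+-suc (c * toℕ u) (toℕ v)) p<)) (λ p≡ → p≢ (trans p≡ (sym position≡)))))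

  copyRow-runs : ∀ {u σ} → RowCopied u 0 σ → Runs copyRow σ (CopiedAt (toℕ u) (c * toℕ u + c)) (suc (c * 3))
  copyRow-runs {u} start = consequence proj₁
    (count {e = reg 10 ⊖ reg 5} (RowCopied u) (λ (s , j≡) → cong₂ _∸_ (size≡ s) j≡) (copy-entry u) start)

  next-row : ∀ (u : Fin c) → c * toℕ u + c ≡ c * suc (toℕ u)
  next-row u = trans (+-comm (c * toℕ u) c) (sym (*-suc c (toℕ u)))

  copy-step : ∀ u {σ} → CopiedAt (toℕ u) (c * toℕ u) σ →
              Runs copyVertex σ (CopiedAt (suc (toℕ u)) (c * suc (toℕ u))) (4 + c * 3)
  copy-step u {σ} s₀ = weaken (≤-reflexive (lemma (c * 3)))
    (reg-then (seq (copyRow-runs {u} (subst (λ w → CopiedAt (toℕ u) w (setReg σ 5 0)) (sym (+-identityʳ (c * toℕ u))) s₀ , refl))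
    λ s → reg-then (reg-end {T = 0} (record
      { order≡  = order≡ s
      ; param≡  = param≡ s
      ; vertex≡ = trans (cong (_+ 1) (vertex≡ s)) (+-comm (toℕ u) 1)
      ; offset≡ = trans (cong₂ _+_ (offset≡ s) (size≡ s)) (next-row u)
      ; size≡   = size≡ s
      ; input≡  = input≡ s
      ; written = λ p p< → written s p (subst (p <_) (sym (next-row u)) p<)
      ; listed  = listed s
      ; offsets = offsets s
      }))))
    where
    lemma : ∀ t → suc (suc t + 2) ≡ 4 + t
    lemma = solve-∀

  copy-runs : ∀ {σ} → ScannedAt (allFin n) n σ →
              Runs copy σ (λ σ′ → Output σ′ (compress I)) (4 + suc (c * suc (4 + c * 3)))
  copy-runs {σ} s = reg-then (reg-then (reg-then (reg-then (consequence output
    (count {e = reg 10 ⊖ reg 4} (λ m → CopiedAt m (c * m)) (λ s → cong₂ _∸_ (size≡ s) (vertex≡ s)) copy-step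
      (record
        { order≡  = size≡ s
        ; param≡  = param≡ s
        ; vertex≡ = refl
        ; offset≡ = sym (*-zeroʳ c)
        ; size≡   = size≡ s
        ; input≡  = input≡ s
        ; written = λ p p< → contradiction (subst (p <_) (*-zeroʳ c) p<) λ ()
        ; listed  = Stores-lookup toℕ (listed s)
        ; offsets = Stores-lookup (λ x → n * toℕ x) (offsets s)
        }))))))
    where
    output : ∀ {σ} → CopiedAt c (c * c) σ → Output σ (compress I)
    output s = record
      { out-order = order≡ s
      ; out-param = param≡ s
      ; out-graph = λ p → trans (written s (toℕ p) (Fin.toℕ<n p)) (input-matrix (compress I) p)
      }

-- Constant instances and the kernelization

noInstance : Instance
noInstance = record
  { order   = 0
  ; graph   = record { adj = λ () ; adj-sym = λ () ; adj-irrefl = λ () }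
  ; param   = 1
  ; 1≤param = s≤s z≤n
  }

-- Parameters are at least 1, so a constant positive instance needs an edge in each colour class:
-- two disjoint edges suffice.
twoEdges : Graph 4
twoEdges = record
  { adj        = adjacent
  ; adj-sym    = from-yes (Fin.all? λ u → Fin.all? λ v → adjacent u v Bool.≟ adjacent v u)
  ; adj-irrefl = from-yes (Fin.all? λ v → adjacent v v Bool.≟ false)
  }
  where
  adjacent : Fin 4 → Fin 4 → Bool
  adjacent zero             (suc zero)             = true
  adjacent (suc zero)       zero                   = true
  adjacent (suc (suc zero)) (suc (suc (suc zero))) = true
  adjacent (suc (suc (suc zero))) (suc (suc zero)) = true
  adjacent _                _                      = false

yesInstance : Instance
yesInstance = record { order = 4 ; graph = twoEdges ; param = 1 ; 1≤param = s≤s z≤n }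

no-noInstance : ¬ YesInstance 2 noInstance
no-noInstance (φ , k≤) with () ← k≤ zero

yes-yesInstance : YesInstance 2 yesInstance
yes-yesInstance = φ , λ where
    zero → s≤s z≤n
    (suc zero) → s≤s z≤n
  where
  φ : Fin 4 → Fin 2
  φ zero = zero
  φ (suc zero) = zero
  φ (suc (suc _)) = suc zero

Large : Instance → Set
Large I = 8 * param I ≤ #edges (graph I)

-- A large instance is positive iff at least k edges avoid each vertex, which
-- need only be tested at a vertex of maximum degree.
Robust : Instance → Set
Robust I = param I + Scan.maxRow I (allFin (order I)) ≤ #edges (graph I)

-- The decisions are arguments of arbitrary type, so that the lemmas below can distinguish cases
-- without unfolding the comparisons in `kernelize`.
select : Instance → {A B : Set} → Dec A → Dec B → Instance
select I (no _)  _       = compress I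
select I (yes _) (yes _) = yesInstance
select I (yes _) (no _)  = noInstance

select-compress : ∀ I {A B : Set} (a? : Dec A) (b? : Dec B) → ¬ A → select I a? b? ≡ compress I
select-compress I (no _)  _ _  = refl
select-compress I (yes a) _ ¬a = contradiction a ¬a

select-yes : ∀ I {A B : Set} (a? : Dec A) (b? : Dec B) → A → B → select I a? b? ≡ yesInstance
select-yes I (yes _) (yes _) _ _ = refl
select-yes I (yes _) (no ¬b) _ b = contradiction b ¬b
select-yes I (no ¬a) _       a _ = contradiction a ¬a

select-no : ∀ I {A B : Set} (a? : Dec A) (b? : Dec B) → A → ¬ B → select I a? b? ≡ noInstance
select-no I (yes _) (no _)  _ _  = refl
select-no I (yes _) (yes b) _ ¬b = contradiction b ¬b
select-no I (no ¬a) _       a _  = contradiction a ¬a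

large? : ∀ I → Dec (Large I)
large? I = 8 * param I ≤? #edges (graph I)

robust? : ∀ I → Dec (Robust I)
robust? I = param I + Scan.maxRow I (allFin (order I)) ≤? #edges (graph I)

kernelize : Instance → Instance
kernelize I = select I (large? I) (robust? I)

-- Equivalence, size and running time of the kernelization

module Correct (I : Instance) where

  private
    n = order I
    k = param I
    m = #edges (graph I)

  open Edges (graph I)
  open Scan I
  open Scanned

  large⇒robust : Large I → YesInstance 2 I → Robust I
  large⇒robust large lcp = begin
    k + maxRow V   ≡⟨ +-comm k (maxRow V) ⟩
    -- `maxRow-least` takes a bound on the degrees alone, hence `e V ∸ k`; `k≤e` makes this
    -- subtraction reversible, also for a graph without vertices.
    maxRow V + k   ≤⟨ m≤o∸n⇒m+n≤o (maxRow V) k≤e (maxRow-least V (λ v → m+n≤o⇒m≤o∸n (row v V) (LCP⇒rest lcp v))) ⟩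
    e V            ≡⟨ #edges≡e ⟨
    m              ∎
    where
    open ≤-Reasoning
    k≤e : k ≤ e V
    k≤e = ≤-trans (m≤n*m k 8) (subst (8 * k ≤_) #edges≡e large)

  large⇒yes : Large I → Robust I → YesInstance 2 I
  large⇒yes large robust = rest⇒LCP (subst (8 * k ≤_) #edges≡e large) λ v → begin
    row v V + k   ≤⟨ +-monoˡ-≤ k (maxRow-upper (∈-allFin v)) ⟩
    maxRow V + k  ≡⟨ +-comm (maxRow V) k ⟩
    k + maxRow V  ≤⟨ robust ⟩
    m             ≡⟨ #edges≡e ⟩
    e V           ∎
    where open ≤-Reasoning

  kernelize-equivalent : YesInstance 2 I ⇔ YesInstance 2 (kernelize I)
  kernelize-equivalent with large? I | robust? I
  ... | no _      | _          = mk⇔ (LCP⇒LCP-induced (graph I)) (LCP-induced⇒LCP (graph I))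
  ... | yes large | yes robust = mk⇔ (λ _ → yes-yesInstance) (λ _ → large⇒yes large robust)
  ... | yes large | no ¬robust =
    mk⇔ (λ lcp → contradiction (large⇒robust large lcp) ¬robust) (λ lcp → contradiction lcp no-noInstance)

  compress-edges : #edges (graph (compress I)) ≡ m
  compress-edges = trans (Edges.#edges≡e induced) (trans (e-induced (graph I)) (sym #edges≡e))

  kernelize-param : param (kernelize I) ≤ 24 * k + 6
  kernelize-param with large? I | robust? I
  ... | no _  | _     = ≤-trans (m≤n*m k 24) (m≤m+n (24 * k) 6)
  ... | yes _ | yes _ = ≤-trans (s≤s z≤n) (m≤n+m 6 (24 * k))
  ... | yes _ | no _  = ≤-trans (s≤s z≤n) (m≤n+m 6 (24 * k))

  kernelize-edges : #edges (graph (kernelize I)) < 8 * k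
  kernelize-edges with large? I | robust? I
  ... | no small | _     = subst (_< 8 * k) (sym compress-edges) (≰⇒> small)
  ... | yes _    | yes _ = <-≤-trans (s≤s (s≤s (s≤s z≤n))) (*-monoʳ-≤ 8 (1≤param I))
  ... | yes _    | no _  = <-≤-trans (s≤s z≤n) (*-monoʳ-≤ 8 (1≤param I))

  -- The 6 is the size of `yesInstance`, four vertices and two edges. In the compressed case there
  -- are fewer than 8k edges and at most twice as many vertices as edges, which gives 3 * 8k.
  kernelize-size : size (kernelize I) ≤ 24 * k + 6
  kernelize-size with large? I | robust? I
  ... | yes _    | yes _ = m≤n+m 6 (24 * k)
  ... | yes _    | no _  = z≤n
  ... | no small | _     = begin
    length kept + #edges induced ≡⟨ cong (length kept +_) compress-edges ⟩
    length kept + m              ≤⟨ +-monoˡ-≤ m (subst (λ t → length kept ≤ 2 * t) (sym #edges≡e) length-kept) ⟩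
    2 * m + m                    ≡⟨ +-comm (2 * m) m ⟩
    3 * m                        ≤⟨ *-monoʳ-≤ 3 (<⇒≤ (≰⇒> small)) ⟩
    3 * (8 * k)                  ≡⟨ *-assoc 3 8 k ⟨
    24 * k                       ≤⟨ m≤m+n (24 * k) 6 ⟩
    24 * k + 6                   ∎
    where open ≤-Reasoning

  answerNo-runs : ∀ {σ T} → Runs answerNo σ (λ σ′ → Output σ′ noInstance) (2 + T)
  answerNo-runs = reg-then (reg-end (record { out-order = refl ; out-param = refl ; out-graph = λ () }))

  answerYes-runs : ∀ {σ T} → (∀ p → arrs σ 1 p ≡ 0) → Runs answerYes σ (λ σ′ → Output σ′ yesInstance) (6 + T)
  answerYes-runs {σ} clear₁ = reg-then (reg-then (arr-then (arr-then (arr-then (arr-end (record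
    { out-order = refl
    ; out-param = refl
    ; out-graph = λ p → trans (written-cong (toℕ p)) (written≡matrix p)
    }))))))
    where
    written : (ℕ → ℕ) → ℕ → ℕ
    written f = update (update (update (update f 1 1) 4 1) 11 1) 14 1
    update-cong : ∀ {f g : ℕ → ℕ} i x → (∀ j → f j ≡ g j) → ∀ j → update f i x j ≡ update g i x j
    update-cong i x f≗g j = cong (if j ≡ᵇ i then x else_) (f≗g j)
    written-cong : ∀ j → written (arrs σ 1) j ≡ written (λ _ → 0) j
    written-cong = update-cong 14 1 (update-cong 11 1 (update-cong 4 1 (update-cong 1 1 clear₁)))
    written≡matrix : ∀ p → written (λ _ → 0) (toℕ p) ≡ matrix twoEdges p
    written≡matrix = from-yes (Fin.all? λ p → written (λ _ → 0) (toℕ p) ≟ matrix twoEdges p)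

  degree-sum : ∀ {σ} → ScannedAt V n σ → regs σ 8 ≡ 2 * m
  degree-sum s = trans (degrees s) (trans (sym (2e≡E V)) (cong (2 *_) (sym #edges≡e)))

  size-test : ∀ {σ} → ScannedAt V n σ →
              ⟦ double (double (double (double (reg 1)))) ⊖ reg 8 ⟧ σ ≡ 2 * (8 * k) ∸ 2 * m
  size-test {σ} s = cong₂ _∸_ (trans (lemma (regs σ 1)) (cong (λ r → 2 * (8 * r)) (param≡ s))) (degree-sum {σ} s)
    where
    lemma : ∀ r → (r + r + (r + r) + (r + r + (r + r))) + (r + r + (r + r) + (r + r + (r + r))) ≡ 2 * (8 * r)
    lemma = solve-∀

  robust-test : ∀ {σ} → ScannedAt V n σ →
                ⟦ double (reg 1 ⊕ reg 9) ⊖ reg 8 ⟧ σ ≡ 2 * (k + maxRow V) ∸ 2 * m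
  robust-test {σ} s = cong₂ _∸_ (trans (lemma (regs σ 1 + regs σ 9))
    (cong (2 *_) (cong₂ _+_ (param≡ s) (max≡ s)))) (degree-sum {σ} s)
    where
    lemma : ∀ r → r + r ≡ 2 * r
    lemma = solve-∀

  passes : ∀ {x t} → t ≡ 2 * x ∸ 2 * m → t ≡ 0 → x ≤ m
  passes t≡ t≡0 = *-cancelˡ-≤ 2 (m∸n≡0⇒m≤n (trans (sym t≡) t≡0))

  fails : ∀ {x t} → t ≡ 2 * x ∸ 2 * m → t ≢ 0 → ¬ x ≤ m
  fails t≡ t≢0 x≤m = t≢0 (trans t≡ (m≤n⇒m∸n≡0 (*-monoʳ-≤ 2 x≤m)))

  copyTime : ℕ
  copyTime = 5 + length kept * (5 + length kept * 3)

  -- The first test costs 1; the 7 covers the second test and the six assignments of `answerYes`.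
  -- Adding `copyTime` bounds both branches at once.
  answer-runs : ∀ {σ} → ScannedAt V n σ →
                Runs answer σ (λ σ′ → Output σ′ (kernelize I)) (suc (7 + copyTime))
  answer-runs {σ} s = cond
    (λ ≢0 → output (select-compress I (large? I) (robust? I) (fails (size-test {σ} s) ≢0))
      (weaken (m≤n+m copyTime 7) (Copy.copy-runs I s)))
    (λ ≡0 → cond
      (λ ≢0 → output (select-no I (large? I) (robust? I) (passes (size-test {σ} s) ≡0) (fails (robust-test {σ} s) ≢0))
        answerNo-runs)
      (λ ≡0′ → output (select-yes I (large? I) (robust? I) (passes (size-test {σ} s) ≡0) (passes (robust-test {σ} s) ≡0′))
        (answerYes-runs (clear s))))
    where
    output : ∀ {J P T} → kernelize I ≡ J →
             Runs P σ (λ σ′ → Output σ′ J) T → Runs P σ (λ σ′ → Output σ′ (kernelize I)) T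
    output refl run = run

  program-runs : Runs program (input I) (λ σ → Output σ (kernelize I)) (24 * bits I ^ 1)
  program-runs = weaken time (seq scan-runs answer-runs)
    where
    c = length kept
    L = ⌈log₂ suc k ⌉
    c≤n : c ≤ n
    c≤n = ≤-trans (length-filter nonisolated? V) (≤-reflexive (length-tabulate (λ j → j)))
    n≤n*n : n ≤ n * n
    n≤n*n = square n
      where
      square : ∀ n → n ≤ n * n
      square zero    = z≤n
      square (suc n) = m≤m*n (suc n) (suc n)
    -- As k ≥ 1, the parameter has at least one bit, which pays for the constant part of the running
    -- time even if the graph is empty.
    1≤L : 1 ≤ L
    1≤L = ⌈log₂⌉-mono-≤ (s≤s (1≤param I))
    -- The total is 3n² + 12n + 3c² + 5c + 14. By c ≤ n ≤ n² and 1 ≤ L it is at most 23n² + 14L, so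
    -- 24 times the number of bits suffices.
    time : suc (n * suc (11 + n * 3)) + suc (7 + copyTime) ≤ 24 * bits I ^ 1
    time = linear (n * n + 10 * L)
      (+-mono-≤ (*-monoʳ-≤ 5 c≤n) (+-mono-≤ (*-monoʳ-≤ 3 (*-mono-≤ c≤n c≤n))
        (+-mono-≤ (*-monoʳ-≤ 17 n≤n*n) (*-monoʳ-≤ 14 1≤L))))
      (lemma n c L)
      where
      lemma : ∀ n c L → suc (n * suc (11 + n * 3)) + suc (7 + (5 + c * (5 + c * 3)))
                        + (5 * n + (3 * (n * n) + (17 * (n * n) + 14 * L))) + (n * n + 10 * L)
                      ≡ 24 * ((n * n + L) * 1) + (5 * c + (3 * (c * c) + (17 * n + 14 * 1)))
      lemma = solve-∀

theorem4 : (∀ (k n : ℕ) (G : Graph n) → Reduced 2 k G → 8 * k ≤ #edges G → LCP 2 k G)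
    × Kernel 2 (λ k → 8 * k)
theorem4 = reduced⇒LCP , record
  { kernelize  = kernelize
  ; polytime   = program , 24 , 1 , Correct.program-runs
  ; equivalent = Correct.kernelize-equivalent
  ; bound      = λ k → 24 * k + 6
  ; param≤     = Correct.kernelize-param
  ; size≤      = Correct.kernelize-size
  ; edges<     = Correct.kernelize-edges
  }
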